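{- Let $q$ be a prime power and let $t$ be an integer with $t=5$ or $t>6$. Then any linear set $L$ of pseudoregulus type in $\mathrm{PG}(1,q^t)$ can be obtained as the projection of two different subgeometries from the same center to the same axis, with no collineation fixing the center and mapping one subgeometry to the other. Precisely: let $\Sigma^*=\mathrm{PG}(t-1,q^t)$, and identify $\mathrm{PG}(1,q^t)$ with a line $\Lambda$ of $\Sigma^*$, so that $L\subset\Lambda$. Then there exist a $(t-3)$-dimensional projective subspace $\Gamma$ of $\Sigma^*$ disjoint from $\Lambda$ and two different canonical subgeometries $\Sigma_1\cong\Sigma_2\cong\mathrm{PG}(t-1,q)$ of $\Sigma^*$, both disjoint from $\Gamma$, such that $$p_{\Gamma,\Lambda}(\Sigma_1)=L=p_{\Gamma,\Lambda}(\Sigma_2),$$ and there exists no collineation $\phi$ of $\Sigma^*$ with $\Gamma^{\phi}=\Gamma$ and $\Sigma_1^{\phi}=\Sigma_2$.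
   Context: For a vector space $V$ over a finite field $F$, the points of the associated projective space are the one-dimensional $F$-subspaces of $V$; $\langle v\rangle_{q^t}$ denotes the point spanned by a nonzero vector $v$ over $\mathbb{F}_{q^t}$. All dimensions of projective subspaces are projective dimensions. A collineation of a projective space is a bijection of its points induced by an invertible semilinear map of the underlying vector space; a projectivity is one induced by an invertible linear map. Canonical subgeometry: let $V$ be an $n$-dimensional vector space over $\mathbb{F}_{q^t}$ and let $W\subset V$ be an $\mathbb{F}_q$-subspace with $\dim_{\mathbb{F}_q}W=n$ whose $\mathbb{F}_{q^t}$-span is $V$. Then $\{\langle w\rangle_{q^t}: w\in W\setminus\{0\}\}$ is a canonical subgeometry (of order $q$) of $\mathrm{PG}(n-1,q^t)$; it is isomorphic to $\mathrm{PG}(n-1,q)$. Projection: if $\Sigma'$ is a canonical subgeometry of $\Sigma^*=\mathrm{PG}(n-1,q^t)$, $\Gamma\subset\Sigma^*\setminus\Sigma'$ is an $(n-1-r)$-subspace, and $\Lambda\subset\Sigma^*\setminus\Gamma$ is an $(r-1)$-subspace, then $p_{\Gamma,\Lambda}(\Sigma')=\{\langle\Gamma,P\rangle\cap\Lambda: P\in\Sigma'\}$ is the projection of $\Sigma'$ from center $\Gamma$ to axis $\Lambda$. Linear set of pseudoregulus type: a point set of $\mathrm{PG}(1,q^t)$, $t\ge 2$, which is projectively equivalent (i.e. equivalent under a projectivity) to $\mathbb{L}=\{\langle(\lambda,\lambda^q)\rangle_{q^t}:\lambda\in\mathbb{F}_{q^t}^*\}$. -}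

module Defs where

open import Algebra.Bundles using (Ring; CommutativeRing)
open import Algebra.Module.Bundles using (LeftModule)
open import Algebra.Morphism.Structures using (IsGroupIsomorphism; IsRingIsomorphism; IsRingHomomorphism)
import Algebra.Module.Construct.DirectProduct as DirectProduct
import Algebra.Module.Construct.TensorUnit as TensorUnit
import Algebra.Module.Morphism.Structures as ModuleMorphisms
import Algebra.Properties.CommutativeMonoid.Sum as Sum
import Algebra.Properties.Semiring.Exp as Exp
open import Data.Fin using (Fin)
open import Data.Nat using (ℕ; suc; _≤_; _^_)
open import Data.Nat.Primality using (Prime)
open import Data.Product using (Σ; ∃-syntax; _×_; _,_)
open import Function.Bundles using (Inverse)
open import Level using (Level; _⊔_) renaming (suc to lsuc)
open import Relation.Binary.PropositionalEquality as ≡ using (_≡_)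
open import Relation.Unary using (Pred; _∈_; _⊆_; _≐_; _∩_; _∪_; U)

private
  variable
    ℓ p : Level

IsPrimePower : ℕ → Set
IsPrimePower q = ∃[ r ] ∃[ k ] (Prime r × 1 ≤ k × q ≡ r ^ k)

record Field ℓ : Set (lsuc ℓ) where
  field
    commutativeRing : CommutativeRing ℓ ℓ

  open CommutativeRing commutativeRing public

  field
    1≉0     : 1# ≉ 0#
    inverse : ∀ {x} → x ≉ 0# → ∃[ y ] x * y ≈ 1#

HasOrder : Field ℓ → ℕ → Set ℓ
HasOrder K n = Inverse (Field.setoid K) (≡.setoid (Fin n))

record FieldExtension (F K : Field ℓ) : Set ℓ where
  private
    module F = Field F
    module K = Field K
  field
    embed              : F.Carrier → K.Carrier
    isRingHomomorphism : IsRingHomomorphism F.rawRing K.rawRing embed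

  open IsRingHomomorphism isRingHomomorphism public

VectorSpace : Field ℓ → Set (lsuc ℓ)
VectorSpace {ℓ} K = LeftModule (Field.ring K) ℓ ℓ

plane : (K : Field ℓ) → VectorSpace K
plane K = DirectProduct.leftModule K¹ K¹
  where K¹ = TensorUnit.leftModule {R = Field.ring K}

restrictScalars : {F K : Field ℓ} → FieldExtension F K → VectorSpace K → VectorSpace F
restrictScalars {F = F} {K} ι V = record
  { Carrierᴹ = Carrierᴹ
  ; _≈ᴹ_ = _≈ᴹ_
  ; _+ᴹ_ = _+ᴹ_
  ; _*ₗ_ = λ a v → embed a *ₗ v
  ; 0ᴹ = 0ᴹ
  ; -ᴹ_ = -ᴹ_
  ; isLeftModule = record
    { isLeftSemimodule = record
      { +ᴹ-isCommutativeMonoid = +ᴹ-isCommutativeMonoid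
      ; isPreleftSemimodule = record
        { *ₗ-cong = λ a≈b u≈v → *ₗ-cong (⟦⟧-cong a≈b) u≈v
        ; *ₗ-zeroˡ = λ v → ≈ᴹ-trans (*ₗ-cong 0#-homo ≈ᴹ-refl) (*ₗ-zeroˡ v)
        ; *ₗ-distribʳ = λ v a b → ≈ᴹ-trans (*ₗ-cong (+-homo a b) ≈ᴹ-refl) (*ₗ-distribʳ v (embed a) (embed b))
        ; *ₗ-identityˡ = λ v → ≈ᴹ-trans (*ₗ-cong 1#-homo ≈ᴹ-refl) (*ₗ-identityˡ v)
        ; *ₗ-assoc = λ a b v → ≈ᴹ-trans (*ₗ-cong (*-homo a b) ≈ᴹ-refl) (*ₗ-assoc (embed a) (embed b) v)
        ; *ₗ-zeroʳ = λ a → *ₗ-zeroʳ (embed a)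
        ; *ₗ-distribˡ = λ a → *ₗ-distribˡ (embed a)
        }
      }
    ; -ᴹ‿cong = -ᴹ‿cong
    ; -ᴹ‿inverse = -ᴹ‿inverse
    }
  }
  where
  open FieldExtension ι
  open LeftModule V

module _ {R : Ring ℓ ℓ} (V : LeftModule R ℓ ℓ) where
  open Ring R using (0#) renaming (Carrier to Scalar; _≈_ to _≈ˢ_)
  open LeftModule V
  open Sum +ᴹ-commutativeMonoid using (sum)

  combination : ∀ {n} → (Fin n → Scalar) → (Fin n → Carrierᴹ) → Carrierᴹ
  combination a x = sum (λ i → a i *ₗ x i)

  LinearlyIndependent : ∀ {n} → (Fin n → Carrierᴹ) → Set ℓ
  LinearlyIndependent b = ∀ a → combination a b ≈ᴹ 0ᴹ → ∀ i → a i ≈ˢ 0#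

  Span : Pred Carrierᴹ p → Pred Carrierᴹ (ℓ ⊔ p)
  Span X v = ∃[ n ] Σ (Fin n → Scalar) λ a → Σ (Fin n → Carrierᴹ) λ x →
    (∀ i → x i ∈ X) × v ≈ᴹ combination a x

  ⟨_⟩ : Carrierᴹ → Pred Carrierᴹ ℓ
  ⟨ v ⟩ u = ∃[ c ] u ≈ᴹ c *ₗ v

  -- Only meaningful, and only used, for predicates that are subspaces.
  HasDim : Pred Carrierᴹ p → ℕ → Set (ℓ ⊔ p)
  HasDim S n = Σ (Fin n → Carrierᴹ) λ b →
    (∀ i → b i ∈ S) × LinearlyIndependent b × (∀ {v} → v ∈ S → ∃[ a ] v ≈ᴹ combination a b)

  HasProjDim : Pred Carrierᴹ p → ℕ → Set (ℓ ⊔ p)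
  HasProjDim S d = HasDim S (suc d)

  record Subspace : Set (lsuc ℓ) where
    field
      Member    : Pred Carrierᴹ ℓ
      resp      : ∀ {u v} → u ≈ᴹ v → Member u → Member v
      0-closed  : Member 0ᴹ
      +-closed  : ∀ {u v} → Member u → Member v → Member (u +ᴹ v)
      *ₗ-closed : ∀ c {v} → Member v → Member (c *ₗ v)

  open Subspace public using (Member)

  -- Two points are the same when their underlying subspaces have the same
  -- vectors (⟦ P ⟧ ≐ ⟦ Q ⟧); propositional equality of points is never used.
  record Point : Set (lsuc ℓ) where
    field
      subspace : Subspace
      dim≡1    : HasDim (Member subspace) 1

    ⟦_⟧ : Pred Carrierᴹ ℓ
    ⟦_⟧ = Member subspace

  open Point public using (⟦_⟧)

  PointSet : ∀ p → Set (lsuc ℓ ⊔ lsuc p)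
  PointSet p = Pred Point p

  points : Subspace → PointSet ℓ
  points S P = ⟦ P ⟧ ⊆ Member S

  projection : (Γ Λ : Subspace) → PointSet p → PointSet (lsuc ℓ ⊔ p)
  projection Γ Λ X Q =
    ∃[ P ] P ∈ X × ⟦ Q ⟧ ≐ (Span (Member Γ ∪ ⟦ P ⟧) ∩ Member Λ)

  -- An invertible semilinear map with companion automorphism σ; it acts on
  -- points through `image` below.
  record Collineation : Set ℓ where
    field
      σ                  : Scalar → Scalar
      isRingIsomorphism  : IsRingIsomorphism (Ring.rawRing R) (Ring.rawRing R) σ
      map                : Carrierᴹ → Carrierᴹ
      isGroupIsomorphism : IsGroupIsomorphism +ᴹ-rawGroup +ᴹ-rawGroup map
      semilinear         : ∀ c v → map (c *ₗ v) ≈ᴹ σ c *ₗ map v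

module _ {R : Ring ℓ ℓ} (V V′ : LeftModule R ℓ ℓ) where
  private
    module V  = LeftModule V
    module V′ = LeftModule V′
  open ModuleMorphisms.LeftModuleMorphisms V.rawLeftModule V′.rawLeftModule

  imageᵛ : (V.Carrierᴹ → V′.Carrierᴹ) → Pred V.Carrierᴹ p → Pred V′.Carrierᴹ (ℓ ⊔ p)
  imageᵛ f S u = ∃[ v ] v ∈ S × u V′.≈ᴹ f v

  image : (V.Carrierᴹ → V′.Carrierᴹ) → PointSet V p → PointSet V′ (lsuc ℓ ⊔ p)
  image f X Q = ∃[ P ] P ∈ X × ⟦ Q ⟧ ≐ imageᵛ f (⟦ P ⟧)

  record LinearIso : Set ℓ where
    field
      map                     : V.Carrierᴹ → V′.Carrierᴹ
      isLeftModuleIsomorphism : IsLeftModuleIsomorphism map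

  record Identification (Λ : Subspace V′) : Set ℓ where
    field
      map                      : V.Carrierᴹ → V′.Carrierᴹ
      isLeftModuleMonomorphism : IsLeftModuleMonomorphism map
      onto                     : Member Λ ≐ imageᵛ map U

-- V is meant to be n-dimensional over K; restrictScalars ι V is V as a vector
-- space over F, so W is an F-subspace of V with dim_F W = n.
IsCanonicalSubgeometry : {F K : Field ℓ} → FieldExtension F K →
  (V : VectorSpace K) → ℕ → PointSet V p → Set (lsuc ℓ ⊔ p)
IsCanonicalSubgeometry ι V n X = Σ (Subspace V/F) λ W →
    HasDim V/F (Member W) n
  × (∀ v → v ∈ Span V (Member W))
  × X ≐ (λ P → ∃[ w ] w ∈ Member W × w ≉ᴹ 0ᴹ × ⟦ P ⟧ ≐ ⟨_⟩ V w)
  where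
  V/F = restrictScalars ι V
  open LeftModule V

𝕃 : (K : Field ℓ) → ℕ → PointSet (plane K) ℓ
𝕃 K q P = ∃[ x ] x ≉ 0# × ⟦ P ⟧ ≐ ⟨_⟩ (plane K) (x , x ^ᴷ q)
  where
  open Field K
  open Exp semiring renaming (_^_ to _^ᴷ_)

IsPseudoregulusType : (K : Field ℓ) → ℕ → PointSet (plane K) p → Set (lsuc ℓ ⊔ p)
IsPseudoregulusType K q L =
  Σ (LinearIso (plane K) (plane K)) λ g →
    L ≐ image (plane K) (plane K) (LinearIso.map g) (𝕃 K q)

module Submission where

-- Write φ(x) = x^q. By Fermat's theorem φ has order t on K = 𝔽_{q^t}; fix s coprime
-- to t with 2 ≤ s ≤ t − 2, which exists since t = 5 or t > 6. Extend the two basis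
-- vectors of Λ given by the identification to a basis e₀, …, e_{t−1} of V, let Γ be
-- spanned by e₂, …, e_{t−1}, and let Σᵣ for r ∈ {1, s} be the subgeometry of the vectors
-- wᵣ(x) = Σⱼ φ^{rj}(x) eⱼ. That these span V is the independence of the distinct
-- characters φ^{rj}, which follows from their orthogonality under summation over K.
-- The projection of Σᵣ is the set of points (x, φʳ(x)). This does not depend on r: if
-- y = Π_{i<m} φ^{ri}(x), then φʳ(y)/y = φ^{rm}(x)/x.
--
-- Let f be a semilinear map with companion automorphism σ inducing a collineation with
-- Γ ↦ Γ and Σ₁ ↦ Σₛ. The coordinates v of f(w₁(x)) = λ wₛ(y) satisfy φˢ(v₀) = κ v₁ and
-- φˢ(v₁) = κ v₂ with κ = φˢ(λ)/λ, hence φˢ(v₀) v₂ = φˢ(v₁) v₁. The latter identity is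
-- quadratic in x, and polarising it shows that κ is the same for all x. Since f preserves
-- Γ, v₀ and v₁ are combinations of z and φ(z) for z = σ(x), so φˢ(v₀) = κ v₁ is a linear
-- relation between the distinct characters 1, φ, φˢ, φ^{s+1}. Hence v₀ = 0 for all x,
-- which is absurd.

open import Defs
open import Algebra.Bundles using (CommutativeMonoid; Ring)
open import Algebra.Module.Bundles using (LeftModule)
import Algebra.Module.Construct.TensorUnit as TensorUnit
import Algebra.Module.Morphism.Structures as ModuleMorphisms
import Algebra.Morphism.Construct.Identity as Identity
open import Algebra.Morphism.Structures using (IsGroupIsomorphism; IsRingIsomorphism)
import Algebra.Properties.CommutativeMonoid.Sum as Sum
import Algebra.Properties.CommutativeSemigroup as CommutativeSemigroupProperties
import Algebra.Properties.CommutativeSemiring.Binomial as Binomial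
import Algebra.Properties.CommutativeSemiring.Exp as Exp
import Algebra.Properties.Group as GroupProperties
import Algebra.Properties.Ring as RingProperties
import Algebra.Properties.Semiring.Mult as Mult
import Algebra.Properties.Semiring.Sum as SemiringSum
import Algebra.Solver.Ring.NaturalCoefficients.Default as SemiringSolver
import Data.Empty as Empty
open import Data.Fin as Fin using (Fin; zero; suc)
open import Data.Fin.Permutation using (↔⇒≡)
import Data.Fin.Properties as Fin
import Data.List as List
import Data.List.Properties as ListProperties
open import Data.Nat as ℕ using (ℕ; zero; suc)
open import Data.Nat.Combinatorics using (_C_; nC1≡n; nCn≡1; k>n⇒nCk≡0; nCk+nC[k+1]≡[n+1]C[k+1])
open import Data.Nat.Divisibility using (_∣_; divides; ∣⇒≤)
open import Data.Nat.Primality using (Prime; euclidsLemma; prime⇒nonZero; prime⇒nonTrivial)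
import Data.Nat.Properties as ℕ
open import Data.Nat.Tactic.RingSolver using (solve-∀)
open import Data.Product using (Σ; ∃; ∃₂; ∃-syntax; _×_; _,_; proj₁; proj₂)
open import Data.Product.Relation.Binary.Pointwise.NonDependent using (×-setoid)
open import Data.Sum using (_⊎_; inj₁; inj₂)
import Data.Vec.Functional as Vector
open import Data.Vec.Functional.Relation.Binary.Equality.Setoid using (≋-setoid)
open import Function using (_∘_; id)
open import Function.Bundles using (Inverse)
import Function.Construct.Composition as Composition
import Function.Construct.Symmetry as Symmetry
open import Level using (Level; _⊔_) renaming (suc to lsuc)
open import Relation.Binary using (Setoid; Decidable; tri<; tri≈; tri>)
open import Relation.Binary.PropositionalEquality as ≡ using (_≡_; _≢_)
import Relation.Binary.Reasoning.Setoid as SetoidReasoning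
open import Relation.Nullary using (Dec; yes; no; ¬_; contradiction)
import Relation.Nullary.Decidable as Dec
open import Relation.Unary using (Pred; U; _∈_; _⊆_; _≐_; _∩_; _∪_; _⊥_)

private
  variable
    ℓ ℓ₁ ℓ₂ ℓ₃ ℓ₄ p : Level
    m n : ℕ

-- The bounds on s make 0, 1, s, s + 1 distinct modulo t, so that the final relation involves four
-- different characters; for s ≡ 1 or s ≡ -1 two of them would coincide. A unit other than ±1 modulo
-- t exists for t = 5 and for t > 6, but not for t = 6. The obstacle is that λ, and with it κ, may
-- depend on x, so that φˢ(v₀) = κ v₁ is not yet a relation between additive functions. Eliminating
-- κ produces one. If κ and κ' belong to x and x', polarisation gives (κ - κ')(v₁(x) v₂(x') - v₁(x')
-- v₂(x)) = 0. When the second factor vanishes, f(w₁(x')) = ρ f(w₁(x)) with ρ the image under σ of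
-- an element fixed by φ; then φˢ fixes ρ, and κ = κ' after all. Orthogonality is preferred to an
-- induction on the number of characters because it recovers each coefficient explicitly, which
-- yields spanning as well as independence.

-- Finite setoids and their cardinalities.

Finite : Setoid ℓ₁ ℓ₂ → ℕ → Set (ℓ₁ ⊔ ℓ₂)
Finite S n = Inverse S (≡.setoid (Fin n))

module FiniteSetoid {S : Setoid ℓ₁ ℓ₂} {n : ℕ} (fin : Finite S n) where
  open Setoid S
  open Inverse fin public using (to; from; to-cong; from-cong)

  from∘to : ∀ x → from (to x) ≈ x
  from∘to = Inverse.strictlyInverseʳ fin

  to∘from : ∀ i → to (from i) ≡ i
  to∘from = Inverse.strictlyInverseˡ fin

  to-injective : ∀ {x y} → to x ≡ to y → x ≈ y
  to-injective {x} {y} eq = trans (sym (from∘to x)) (trans (from-cong eq) (from∘to y))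

  infix 4 _≟_
  _≟_ : Decidable _≈_
  x ≟ y = Dec.map′ to-injective to-cong (to x Fin.≟ to y)

  search : {P : Pred Carrier p} → (∀ {x y} → x ≈ y → P x → P y) →
           (∀ x → Dec (P x)) → Dec (∃ P)
  search resp P? = Dec.map′
    (λ (i , Pi) → from i , Pi)
    (λ (x , Px) → to x , resp (sym (from∘to x)) Px)
    (Fin.any? (P? ∘ from))

-- Supplies both the number of coefficient families, from which dimensions are read off, and the
-- enumeration searched by `inSpan?`.
functions-finite : {S : Setoid ℓ₁ ℓ₂} {n : ℕ} → Finite S n → ∀ m → Finite (≋-setoid S m) (n ℕ.^ m)
functions-finite {S = S} {n} fin m = record
  { to        = λ f → Fin.funToFin (to ∘ f)
  ; from      = λ k i → from (Fin.finToFun {n} {m} k i)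
  ; to-cong   = λ f≋g → funToFin-cong (λ i → to-cong (f≋g i))
  ; from-cong = λ { ≡.refl i → Setoid.refl S }
  ; inverse   =
      (λ {k} f≋ → ≡.trans (funToFin-cong (λ i → ≡.trans (to-cong (f≋ i)) (to∘from _)))
                          (Fin.funToFin-finToFin {m} k))
    , (λ {f} k≡ i → Setoid.trans S (from-cong (≡.trans (≡.cong (λ k → Fin.finToFun {n} {m} k i) k≡)
                                                        (Fin.finToFun-funToFin (to ∘ f) i)))
                                    (from∘to (f i)))
  }
  where
  open FiniteSetoid fin
  funToFin-cong : ∀ {m} {f g : Fin m → Fin n} → (∀ i → f i ≡ g i) → Fin.funToFin f ≡ Fin.funToFin g
  funToFin-cong {zero}  f≗g = ≡.refl
  funToFin-cong {suc m} f≗g = ≡.cong₂ Fin.combine (f≗g zero) (funToFin-cong (f≗g ∘ suc))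

×-finite : {S : Setoid ℓ₁ ℓ₂} {T : Setoid ℓ₃ ℓ₄} {m n : ℕ} →
           Finite S m → Finite T n → Finite (×-setoid S T) (m ℕ.* n)
×-finite {m = m} {n} finS finT = record
  { to        = λ (x , y) → Fin.combine (S.to x) (T.to y)
  ; from      = λ k → S.from (proj₁ (Fin.remQuot {m} n k)) , T.from (proj₂ (Fin.remQuot {m} n k))
  ; to-cong   = λ (x≈ , y≈) → ≡.cong₂ Fin.combine (S.to-cong x≈) (T.to-cong y≈)
  ; from-cong = λ { ≡.refl → S.from-cong ≡.refl , T.from-cong ≡.refl }
  ; inverse   =
      (λ {k} (x≈ , y≈) → ≡.trans
        (≡.cong₂ Fin.combine (≡.trans (S.to-cong x≈) (S.to∘from _)) (≡.trans (T.to-cong y≈) (T.to∘from _)))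
        (Fin.combine-remQuot {m} n k))
    , (λ { {x , y} ≡.refl →
           S.to-injective (≡.trans (S.to∘from _) (≡.cong proj₁ (Fin.remQuot-combine (S.to x) (T.to y))))
         , T.to-injective (≡.trans (T.to∘from _) (≡.cong proj₂ (Fin.remQuot-combine (S.to x) (T.to y)))) })
  }
  where
  module S = FiniteSetoid finS
  module T = FiniteSetoid finT

finite-unique : {S : Setoid ℓ₁ ℓ₂} {T : Setoid ℓ₃ ℓ₄} {m n : ℕ} →
                Finite S m → Finite T n → Inverse S T → m ≡ n
finite-unique finS finT S↔T =
  ↔⇒≡ (Composition.inverse (Symmetry.inverse finS) (Composition.inverse S↔T finT))

-- Elementary field arithmetic.

module FieldProperties (K : Field ℓ) where
  open Field K public hiding (zero)
  open Exp commutativeSemiring public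
  open RingProperties ring public
    using (-‿distribˡ-*; -‿distribʳ-*; -‿involutive; -0#≈0#; +-cancelˡ; +-cancelʳ)
    renaming (x∙y⁻¹≈ε⇒x≈y to x-y≈0⇒x≈y; x≈y⇒x∙y⁻¹≈ε to x≈y⇒x-y≈0)
  open SetoidReasoning setoid

  *-zero-cancelˡ : ∀ {x y} → x ≉ 0# → x * y ≈ 0# → y ≈ 0#
  *-zero-cancelˡ {x} {y} x≉0 xy≈0 = let (x⁻¹ , xx⁻¹≈1) = inverse x≉0 in begin
    y             ≈⟨ *-identityˡ y ⟨
    1# * y        ≈⟨ *-congʳ (trans (*-comm x⁻¹ x) xx⁻¹≈1) ⟨
    x⁻¹ * x * y   ≈⟨ *-assoc x⁻¹ x y ⟩
    x⁻¹ * (x * y) ≈⟨ *-congˡ xy≈0 ⟩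
    x⁻¹ * 0#      ≈⟨ zeroʳ x⁻¹ ⟩
    0#            ∎

  *-≉0 : ∀ {x y} → x ≉ 0# → y ≉ 0# → x * y ≉ 0#
  *-≉0 x≉0 y≉0 xy≈0 = y≉0 (*-zero-cancelˡ x≉0 xy≈0)

  *-cancelˡ : ∀ {x y z} → x ≉ 0# → x * y ≈ x * z → y ≈ z
  *-cancelˡ {x} {y} {z} x≉0 xy≈xz = x-y≈0⇒x≈y y z (*-zero-cancelˡ x≉0 (begin
    x * (y + - z)       ≈⟨ distribˡ x y (- z) ⟩
    x * y + x * (- z)   ≈⟨ +-congˡ (-‿distribʳ-* x z) ⟨
    x * y + - (x * z)   ≈⟨ x≈y⇒x-y≈0 xy≈xz ⟩
    0#                  ∎))

  ^-≉0 : ∀ {x} n → x ≉ 0# → x ^ n ≉ 0#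
  ^-≉0 zero    x≉0 = 1≉0
  ^-≉0 (suc n) x≉0 = *-≉0 x≉0 (^-≉0 n x≉0)

  0^ : ∀ n → .{{ℕ.NonZero n}} → 0# ^ n ≈ 0#
  0^ (suc n) = zeroˡ _

  1^ : ∀ n → 1# ^ n ≈ 1#
  1^ zero    = refl
  1^ (suc n) = trans (*-identityˡ _) (1^ n)

-- Sums and products over all elements of a finite field.

module TotalSum {S : Setoid ℓ₁ ℓ₂} {N : ℕ} (fin : Finite S N) (M : CommutativeMonoid ℓ₃ ℓ₄) where
  private
    module S = Setoid S
    module M = CommutativeMonoid M
  open FiniteSetoid fin
  open Sum M

  total : (S.Carrier → M.Carrier) → M.Carrier
  total f = sum (f ∘ from)

  -- The common source of `N·1≈0`, `fermat` and `orthogonal`, with a translation or a dilation of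
  -- the field for `π`.
  total-reindex : (f : S.Carrier → M.Carrier) → (∀ {x y} → x S.≈ y → f x M.≈ f y) →
                  (π : Inverse S S) → total f M.≈ total (f ∘ Inverse.to π)
  total-reindex f f-cong π = M.trans (sum-permute (f ∘ from) permutation)
    (sum-cong-≋ {N} (λ i → f-cong (from∘to (Inverse.to π (from i)))))
    where
    permutation = Composition.inverse (Symmetry.inverse fin) (Composition.inverse π fin)

module FiniteField (K : Field ℓ) {N : ℕ} (fin : HasOrder K N) where
  open FieldProperties K
  open FiniteSetoid fin
  open Mult semiring using () renaming (_×_ to _·_)
  open SetoidReasoning setoid

  open TotalSum fin +-commutativeMonoid public
  open SemiringSum semiring using (sum; ∑-distrib-+; sum-cong-≋; sum-replicate)
  private
    module ∏ = TotalSum fin *-commutativeMonoid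
    module ∏ˢ = Sum *-commutativeMonoid

  total-cong : ∀ {f g : Carrier → Carrier} → (∀ x → f x ≈ g x) → total f ≈ total g
  total-cong f≈g = sum-cong-≋ {N} (λ i → f≈g (from i))

  zero? : ∀ x → Dec (x ≈ 0#)
  zero? x = x ≟ 0#

  translation : Carrier → Inverse setoid setoid
  translation a = record
    { to        = λ x → x + a
    ; from      = λ x → x + - a
    ; to-cong   = +-congʳ
    ; from-cong = +-congʳ
    ; inverse   = (λ {y} x≈ → trans (+-congʳ x≈) (trans (+-assoc y (- a) a) (trans (+-congˡ (-‿inverseˡ a)) (+-identityʳ y))))
                , (λ {y} x≈ → trans (+-congʳ x≈) (trans (+-assoc y a (- a)) (trans (+-congˡ (-‿inverseʳ a)) (+-identityʳ y))))
    }

  dilation : ∀ {a} → a ≉ 0# → Inverse setoid setoid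
  dilation {a} a≉0 = let (a⁻¹ , aa⁻¹≈1) = inverse a≉0 in record
    { to        = a *_
    ; from      = a⁻¹ *_
    ; to-cong   = *-congˡ
    ; from-cong = *-congˡ
    ; inverse   = (λ {y} x≈ → trans (*-congˡ x≈) (trans (sym (*-assoc a a⁻¹ y)) (trans (*-congʳ aa⁻¹≈1) (*-identityˡ y))))
                , (λ {y} x≈ → trans (*-congˡ x≈) (trans (sym (*-assoc a⁻¹ a y)) (trans (*-congʳ (trans (*-comm a⁻¹ a) aa⁻¹≈1)) (*-identityˡ y))))
    }

  -- Translation by 1 permutes the field, so adding 1 to each of the `N` summands leaves the sum of
  -- all elements unchanged.
  N·1≈0 : N · 1# ≈ 0#
  N·1≈0 = +-cancelˡ (total (λ x → x)) (N · 1#) 0# (begin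
    total (λ x → x) + N · 1#           ≈⟨ +-congˡ (sum-replicate N) ⟨
    total (λ x → x) + sum {N} (λ _ → 1#)   ≈⟨ ∑-distrib-+ from (λ _ → 1#) ⟨
    total (λ x → x + 1#)               ≈⟨ total-reindex (λ x → x) (λ x≈y → x≈y) (translation 1#) ⟨
    total (λ x → x)                    ≈⟨ +-identityʳ _ ⟨
    total (λ x → x) + 0#               ∎)

  1<N : 1 ℕ.< N
  1<N with N ℕ.≤? 1
  ... | no  N≰1 = ℕ.≰⇒> N≰1
  ... | yes N≤1 = contradiction (to-injective (Fin.toℕ-injective (≡.trans (below (to 1#)) (≡.sym (below (to 0#)))))) 1≉0
    where
    below : (i : Fin N) → Fin.toℕ i ≡ 0
    below i = ℕ.n<1⇒n≡0 (ℕ.<-≤-trans (Fin.toℕ<n i) N≤1)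

  instance
    N-nonZero : ℕ.NonZero N
    N-nonZero = ℕ.>-nonZero (ℕ.<-trans (ℕ.s≤s ℕ.z≤n) 1<N)

  module _ {a} {A : Set a} where
    ifZero_then_else_ : Carrier → A → A → A
    ifZero x then u else v with x ≟ 0#
    ... | yes _ = u
    ... | no  _ = v

    ifZero-yes : ∀ {x} {u v : A} → x ≈ 0# → ifZero x then u else v ≡ u
    ifZero-yes {x} x≈0 with x ≟ 0#
    ... | yes _   = ≡.refl
    ... | no  x≉0 = contradiction x≈0 x≉0

    ifZero-no : ∀ {x} {u v : A} → x ≉ 0# → ifZero x then u else v ≡ v
    ifZero-no {x} x≉0 with x ≟ 0#
    ... | yes x≈0 = contradiction x≈0 x≉0
    ... | no  _   = ≡.refl

  -- Both the product over the nonzero elements and the number of nonzero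
  -- elements are instances of a fold with one value at 0 and another elsewhere.
  module _ (M : CommutativeMonoid ℓ ℓ) where
    private module M = CommutativeMonoid M
    open TotalSum fin M using () renaming (total to totalᴹ)

    total-ifZero : ∀ {f u v} → (∀ {x} → x ≈ 0# → f x M.≈ u) → (∀ {x} → x ≉ 0# → f x M.≈ v) →
                   totalᴹ f M.≈ u M.∙ Sum.sum M (Vector.replicate (ℕ.pred N) v)
    total-ifZero {f} {u} {v} f0 f1 = go fin ≡.refl
      where
      -- The length is generalised so that it can be a successor, from which the index of `0#` is
      -- removed.
      go : ∀ {n} (fin′ : HasOrder K n) → n ≡ N → TotalSum.total fin′ M f M.≈ u M.∙ Sum.sum M (Vector.replicate (ℕ.pred N) v)
      go {zero} fin′ _ = contradiction (Inverse.to fin′ 0#) λ ()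
      go {suc n} fin′ ≡.refl = M.trans (Sum.sum-remove M {i = F′.to 0#} (f ∘ F′.from))
        (M.∙-cong (f0 (F′.from∘to 0#)) (Sum.sum-cong-≋ M (λ i → f1 (λ eq →
          Fin.punchInᵢ≢i (F′.to 0#) i (≡.trans (≡.sym (F′.to∘from _)) (F′.to-cong eq))))))
        where module F′ = FiniteSetoid fin′

  private
    ∏-≉0 : ∀ {n} (f : Fin n → Carrier) → (∀ i → f i ≉ 0#) → ∏ˢ.sum f ≉ 0#
    ∏-≉0 {zero}  f f≉0 = 1≉0
    ∏-≉0 {suc n} f f≉0 = *-≉0 (f≉0 zero) (∏-≉0 (f ∘ suc) (f≉0 ∘ suc))

  -- Multiplication by `g` permutes the nonzero elements, so their product is unchanged when each of
  -- the N - 1 factors acquires a factor `g`; that product is nonzero and cancels.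
  fermat : ∀ {x} → x ≉ 0# → x ^ ℕ.pred N ≈ 1#
  fermat {g} g≉0 = *-cancelˡ ∏-nz≉0 (begin
    ∏.total nz * g ^ ℕ.pred N                         ≈⟨ *-congˡ ∏h ⟨
    ∏.total nz * ∏.total h                            ≈⟨ ∏ˢ.∑-distrib-+ (nz ∘ from) (h ∘ from) ⟨
    ∏.total (λ x → nz x * h x)                        ≈⟨ ∏ˢ.sum-cong-≋ {N} (λ i → nz-dilate (from i)) ⟨
    ∏.total (λ x → nz (g * x))                        ≈⟨ ∏.total-reindex nz nz-cong (dilation g≉0) ⟨
    ∏.total nz                                        ≈⟨ *-identityʳ _ ⟨
    ∏.total nz * 1#                                   ∎)
    where
    nz h : Carrier → Carrier
    -- The value 1 at zero lets the product run over the whole field, on which the dilation acts,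
    -- without becoming zero.
    nz x = ifZero x then 1# else x
    h  x = ifZero x then 1# else g

    nz-≉0 : ∀ x → nz x ≉ 0#
    nz-≉0 x with x ≟ 0#
    ... | yes _   = 1≉0
    ... | no  x≉0 = x≉0

    nz-cong : ∀ {x y} → x ≈ y → nz x ≈ nz y
    nz-cong {x} {y} x≈y with x ≟ 0# | y ≟ 0#
    ... | yes _   | yes _   = refl
    ... | no  _   | no  _   = x≈y
    ... | yes x≈0 | no  y≉0 = contradiction (trans (sym x≈y) x≈0) y≉0
    ... | no  x≉0 | yes y≈0 = contradiction (trans x≈y y≈0) x≉0

    nz-dilate : ∀ x → nz (g * x) ≈ nz x * h x
    nz-dilate x with x ≟ 0#
    ... | yes x≈0 = trans (reflexive (ifZero-yes (trans (*-congˡ x≈0) (zeroʳ g)))) (sym (*-identityˡ 1#))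
    ... | no  x≉0 = trans (reflexive (ifZero-no (*-≉0 g≉0 x≉0))) (*-comm g x)

    ∏-nz≉0 : ∏.total nz ≉ 0#
    ∏-nz≉0 = ∏-≉0 (nz ∘ from) (nz-≉0 ∘ from)

    ∏h : ∏.total h ≈ g ^ ℕ.pred N
    ∏h = trans (total-ifZero *-commutativeMonoid (λ x≈0 → reflexive (ifZero-yes x≈0)) (λ x≉0 → reflexive (ifZero-no x≉0)))
      (trans (*-identityˡ _) (∏ˢ.sum-replicate (ℕ.pred N)))

  x^N≈x : ∀ x → x ^ N ≈ x
  x^N≈x x with x ≟ 0#
  ... | yes x≈0 = trans (^-congˡ N x≈0) (trans (0^ N) (sym x≈0))
  ... | no  x≉0 = begin
    x ^ N              ≡⟨ ≡.cong (x ^_) (ℕ.suc-pred N) ⟨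
    x * x ^ ℕ.pred N   ≈⟨ *-congˡ (fermat x≉0) ⟩
    x * 1#             ≈⟨ *-identityʳ x ⟩
    x                  ∎

-- Linear combinations in a module.

module Combinations {R : Ring ℓ ℓ} (V : LeftModule R ℓ ℓ) where
  private module R = Ring R
  open R using (_≈_; _+_; _*_; -_; 0#) renaming (Carrier to Scalar)
  open LeftModule V public
  open Sum +ᴹ-commutativeMonoid using (sum; sum-cong-≋; ∑-distrib-+; sum-replicate-zero)
  open SetoidReasoning ≈ᴹ-setoid
  open GroupProperties +ᴹ-group public
    using ()
    renaming ( inverseˡ-unique to +ᴹ-inverseˡ-unique; inverseʳ-unique to +ᴹ-inverseʳ-unique
             ; ⁻¹-involutive to -ᴹ‿involutive)

  -‿*ₗ : ∀ c v → (- c) *ₗ v ≈ᴹ -ᴹ (c *ₗ v)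
  -‿*ₗ c v = +ᴹ-inverseˡ-unique _ _ (begin
    (- c) *ₗ v +ᴹ c *ₗ v  ≈⟨ *ₗ-distribʳ v (- c) c ⟨
    (- c + c) *ₗ v        ≈⟨ *ₗ-congʳ (R.-‿inverseˡ c) ⟩
    0# *ₗ v               ≈⟨ *ₗ-zeroˡ v ⟩
    0ᴹ                    ∎)

  *ₗ-distribˡ-sum : ∀ {n} c (x : Fin n → Carrierᴹ) → c *ₗ sum x ≈ᴹ sum (λ i → c *ₗ x i)
  *ₗ-distribˡ-sum {zero}  c x = *ₗ-zeroʳ c
  *ₗ-distribˡ-sum {suc n} c x =
    ≈ᴹ-trans (*ₗ-distribˡ c _ _) (+ᴹ-congˡ (*ₗ-distribˡ-sum c (x ∘ suc)))

  *ₗ-distribʳ-sum : ∀ {n} (a : Fin n → Scalar) v →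
                    Sum.sum R.+-commutativeMonoid a *ₗ v ≈ᴹ sum (λ i → a i *ₗ v)
  *ₗ-distribʳ-sum {zero}  a v = *ₗ-zeroˡ v
  *ₗ-distribʳ-sum {suc n} a v =
    ≈ᴹ-trans (*ₗ-distribʳ v _ _) (+ᴹ-congˡ (*ₗ-distribʳ-sum (a ∘ suc) v))

  combination-cong : ∀ {n} {a b : Fin n → Scalar} {x y : Fin n → Carrierᴹ} →
                     (∀ i → a i ≈ b i) → (∀ i → x i ≈ᴹ y i) → combination V a x ≈ᴹ combination V b y
  combination-cong {n} a≈b x≈y = sum-cong-≋ {n} (λ i → *ₗ-cong (a≈b i) (x≈y i))

  combination-congˡ : ∀ {n} {a b : Fin n → Scalar} (x : Fin n → Carrierᴹ) →
                      (∀ i → a i ≈ b i) → combination V a x ≈ᴹ combination V b x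
  combination-congˡ x a≈b = combination-cong a≈b (λ _ → ≈ᴹ-refl)

  combination-+ : ∀ {n} (a b : Fin n → Scalar) (x : Fin n → Carrierᴹ) →
                  combination V (λ i → a i + b i) x ≈ᴹ combination V a x +ᴹ combination V b x
  combination-+ {n} a b x =
    ≈ᴹ-trans (sum-cong-≋ {n} (λ i → *ₗ-distribʳ (x i) (a i) (b i))) (∑-distrib-+ {n} _ _)

  combination-* : ∀ {n} c (a : Fin n → Scalar) (x : Fin n → Carrierᴹ) →
                  combination V (λ i → c * a i) x ≈ᴹ c *ₗ combination V a x
  combination-* {n} c a x =
    ≈ᴹ-trans (sum-cong-≋ {n} (λ i → *ₗ-assoc c (a i) (x i))) (≈ᴹ-sym (*ₗ-distribˡ-sum {n} c _))

  combination-0 : ∀ {n} {a : Fin n → Scalar} (x : Fin n → Carrierᴹ) →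
                  (∀ i → a i ≈ 0#) → combination V a x ≈ᴹ 0ᴹ
  combination-0 {n} x a≈0 =
    ≈ᴹ-trans (sum-cong-≋ {n} (λ i → ≈ᴹ-trans (*ₗ-congʳ (a≈0 i)) (*ₗ-zeroˡ (x i)))) (sum-replicate-zero n)

  combination-neg : ∀ {n} (a : Fin n → Scalar) (x : Fin n → Carrierᴹ) →
                    combination V (λ i → - a i) x ≈ᴹ -ᴹ combination V a x
  combination-neg a x = +ᴹ-inverseˡ-unique _ _ (≈ᴹ-trans (≈ᴹ-sym (combination-+ (λ i → - a i) a x))
    (combination-0 x (λ i → R.-‿inverseˡ (a i))))

  combination-single : ∀ {n} {a : Fin n → Scalar} (x : Fin n → Carrierᴹ) i →
                       (∀ j → j ≢ i → a j ≈ 0#) → combination V a x ≈ᴹ a i *ₗ x i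
  combination-single {suc n} x zero    a≈0 =
    ≈ᴹ-trans (+ᴹ-congˡ (combination-0 (x ∘ suc) (λ j → a≈0 (suc j) λ ()))) (+ᴹ-identityʳ _)
  combination-single {suc n} x (suc i) a≈0 =
    ≈ᴹ-trans (+ᴹ-cong (≈ᴹ-trans (*ₗ-congʳ (a≈0 zero λ ())) (*ₗ-zeroˡ _))
                      (combination-single (x ∘ suc) i (λ j j≢i → a≈0 (suc j) (j≢i ∘ Fin.suc-injective))))
             (+ᴹ-identityˡ _)

  combination-linear : ∀ {n} (W : LeftModule R ℓ ℓ) (let module W = LeftModule W) (f : Carrierᴹ → W.Carrierᴹ) →
    (f 0ᴹ W.≈ᴹ W.0ᴹ) → (∀ u v → f (u +ᴹ v) W.≈ᴹ f u W.+ᴹ f v) → (∀ c v → f (c *ₗ v) W.≈ᴹ c W.*ₗ f v) →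
    (a : Fin n → Scalar) (x : Fin n → Carrierᴹ) → f (combination V a x) W.≈ᴹ combination W a (f ∘ x)
  combination-linear {zero}  W f f-0 f-+ f-* a x = f-0
  combination-linear {suc n} W f f-0 f-+ f-* a x =
    W.≈ᴹ-trans (f-+ _ _) (W.+ᴹ-cong (f-* _ _) (combination-linear W f f-0 f-+ f-* (a ∘ suc) (x ∘ suc)))
    where module W = LeftModule W

-- Orthogonality, independence and spanning for multiplicative characters.

module Characters (K : Field ℓ) {N : ℕ} (fin : HasOrder K N) where
  open FieldProperties K
  open FiniteSetoid fin
  open FiniteField K fin
  open Mult semiring using () renaming (_×_ to _·_)
  open SetoidReasoning setoid

  -- Multiplicative on all of K; its value at 0 plays no role, as it only occurs multiplied by a power of 0.
  reciprocal : Carrier → Carrier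
  reciprocal x = x ^ (N ℕ.∸ 2)

  *-reciprocal : ∀ {x} → x ≉ 0# → x * reciprocal x ≈ 1#
  *-reciprocal {x} x≉0 = trans (reflexive (≡.cong (x ^_) exponent)) (fermat x≉0)
    where
    exponent : suc (N ℕ.∸ 2) ≡ ℕ.pred N
    exponent = ≡.trans (≡.sym (ℕ.+-∸-assoc 1 1<N)) ≡.refl

  private
    -- The character x ^ (e - d) without negative exponents; for nonzero `e` it vanishes at zero.
    ψ : ℕ → ℕ → Carrier → Carrier
    ψ d e x = reciprocal (x ^ d) * x ^ e

    ψ-cong : ∀ d e {x y} → x ≈ y → ψ d e x ≈ ψ d e y
    ψ-cong d e x≈y = *-cong (^-congˡ (N ℕ.∸ 2) (^-congˡ d x≈y)) (^-congˡ e x≈y)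

    ψ-* : ∀ d e x y → ψ d e (x * y) ≈ ψ d e x * ψ d e y
    ψ-* d e x y = begin
      reciprocal ((x * y) ^ d) * (x * y) ^ e
        ≈⟨ *-cong (trans (^-congˡ (N ℕ.∸ 2) (^-distrib-* x y d)) (^-distrib-* _ _ (N ℕ.∸ 2))) (^-distrib-* x y e) ⟩
      reciprocal (x ^ d) * reciprocal (y ^ d) * (x ^ e * y ^ e)
        ≈⟨ *-interchange _ _ _ _ ⟩
      ψ d e x * ψ d e y ∎
      where open CommutativeSemigroupProperties *-commutativeSemigroup using () renaming (interchange to *-interchange)

    ψ≈1 : ∀ d e {x} → x ≉ 0# → ψ d e x ≈ 1# → x ^ d ≈ x ^ e
    ψ≈1 d e {x} x≉0 ψ≈1 = begin
      x ^ d                                 ≈⟨ *-identityʳ _ ⟨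
      x ^ d * 1#                            ≈⟨ *-congˡ ψ≈1 ⟨
      x ^ d * (reciprocal (x ^ d) * x ^ e)  ≈⟨ *-assoc _ _ _ ⟨
      x ^ d * reciprocal (x ^ d) * x ^ e    ≈⟨ *-congʳ (*-reciprocal (^-≉0 d x≉0)) ⟩
      1# * x ^ e                            ≈⟨ *-identityˡ _ ⟩
      x ^ e                                 ∎

  -- Dilation by a nonzero x multiplies the sum by `ψ d e x` but only permutes its terms. A nonzero
  -- sum would therefore force `ψ d e` to be trivial.
  orthogonal : ∀ d e → .{{ℕ.NonZero d}} → .{{ℕ.NonZero e}} →
               ¬ (∀ x → x ^ d ≈ x ^ e) → total (λ x → reciprocal (x ^ d) * x ^ e) ≈ 0#
  orthogonal d e d≢e with total (ψ d e) ≟ 0#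
  ... | yes sum≈0 = sum≈0
  ... | no  sum≉0 = contradiction agree d≢e
    where
    open SemiringSum semiring using (*-distribˡ-sum)
    agree : ∀ x → x ^ d ≈ x ^ e
    agree x with x ≟ 0#
    ... | yes x≈0 = trans (trans (^-congˡ d x≈0) (0^ d)) (sym (trans (^-congˡ e x≈0) (0^ e)))
    ... | no  x≉0 = ψ≈1 d e x≉0 (*-cancelˡ sum≉0 (begin
      total (ψ d e) * ψ d e x          ≈⟨ *-comm _ _ ⟩
      ψ d e x * total (ψ d e)          ≈⟨ *-distribˡ-sum {N} _ _ ⟩
      total (λ y → ψ d e x * ψ d e y)  ≈⟨ total-cong (λ y → ψ-* d e x y) ⟨
      total (λ y → ψ d e (x * y))      ≈⟨ total-reindex (ψ d e) (ψ-cong d e) (dilation x≉0) ⟨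
      total (ψ d e)                    ≈⟨ *-identityʳ _ ⟨
      total (ψ d e) * 1#               ∎))

  -- The summand is 1 at the N - 1 nonzero elements and 0 at zero, while N · 1 = 0 in the field.
  normal : ∀ d → .{{ℕ.NonZero d}} → total (λ x → reciprocal (x ^ d) * x ^ d) ≈ - 1#
  normal d = +-inverseʳ-unique 1# _ (begin
    1# + total (ψ d d)                   ≈⟨ +-congˡ (total-ifZero +-commutativeMonoid
      (λ x≈0 → trans (*-congˡ (trans (^-congˡ d x≈0) (0^ d))) (zeroʳ _))
      (λ x≉0 → trans (*-comm _ _) (*-reciprocal (^-≉0 d x≉0)))) ⟩
    1# + (0# + sum (Vector.replicate (ℕ.pred N) 1#)) ≈⟨ +-congˡ (trans (+-identityˡ _) (sum-replicate (ℕ.pred N))) ⟩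
    suc (ℕ.pred N) · 1#                  ≡⟨ ≡.cong (_· 1#) (ℕ.suc-pred N) ⟩
    N · 1#                               ≈⟨ N·1≈0 ⟩
    0#                                   ∎)
    where
    open Sum +-commutativeMonoid using (sum; sum-replicate)
    open RingProperties ring using (+-inverseʳ-unique)

  -- Distinctness as functions on the field, which is stronger than that of the exponents because x
  -- ^ N = x.
  Distinct : (Fin n → ℕ) → Set ℓ
  Distinct e = ∀ i j → i ≢ j → ¬ (∀ x → x ^ e i ≈ x ^ e j)

  module _ (V : VectorSpace K) where
    open Combinations V
    open TotalSum fin +ᴹ-commutativeMonoid using () renaming (total to totalᴹ)
    open Sum +ᴹ-commutativeMonoid using (sum; sum-cong-≋; ∑-comm)
    private module V = SetoidReasoning ≈ᴹ-setoid

    -- After interchanging the two sums, `orthogonal` removes every term but the `i`-th, and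
    -- `normal` evaluates that one. Vector-valued coefficients let `independence` and `spanning`
    -- share this formula.
    coefficient : (e : Fin n → ℕ) → (∀ i → ℕ.NonZero (e i)) → Distinct e → (v : Fin n → Carrierᴹ) → ∀ i →
                  totalᴹ (λ x → reciprocal (x ^ e i) *ₗ combination V (λ j → x ^ e j) v) ≈ᴹ -ᴹ v i
    coefficient {n} e e≢0 distinct v i = V.begin
      totalᴹ (λ x → reciprocal (x ^ e i) *ₗ combination V (λ j → x ^ e j) v)
        V.≈⟨ sum-cong-≋ {N} (λ k → combination-* _ (λ j → from k ^ e j) v) ⟨
      totalᴹ (λ x → combination V (λ j → ψ (e i) (e j) x) v)
        V.≈⟨ ∑-comm {N} {n} (λ k j → ψ (e i) (e j) (from k) *ₗ v j) ⟩
      sum (λ j → totalᴹ (λ x → ψ (e i) (e j) x *ₗ v j))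
        V.≈⟨ sum-cong-≋ {n} (λ j → *ₗ-distribʳ-sum {N} _ (v j)) ⟨
      combination V (λ j → total (ψ (e i) (e j))) v
        V.≈⟨ combination-single v i (λ j j≢i →
               orthogonal (e i) (e j) {{e≢0 i}} {{e≢0 j}} (distinct i j (j≢i ∘ ≡.sym))) ⟩
      total (ψ (e i) (e i)) *ₗ v i
        V.≈⟨ *ₗ-congʳ (normal (e i) {{e≢0 i}}) ⟩
      (- 1#) *ₗ v i
        V.≈⟨ -‿*ₗ 1# (v i) ⟩
      -ᴹ (1# *ₗ v i)
        V.≈⟨ -ᴹ‿cong (*ₗ-identityˡ (v i)) ⟩
      -ᴹ v i V.∎

    independence : (e : Fin n → ℕ) → (∀ i → ℕ.NonZero (e i)) → Distinct e → (v : Fin n → Carrierᴹ) →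
                   (∀ x → combination V (λ j → x ^ e j) v ≈ᴹ 0ᴹ) → ∀ i → v i ≈ᴹ 0ᴹ
    independence e e≢0 distinct v vanishes i = V.begin
      v i                V.≈⟨ -ᴹ‿involutive (v i) ⟨
      -ᴹ (-ᴹ v i)        V.≈⟨ -ᴹ‿cong (coefficient e e≢0 distinct v i) ⟨
      -ᴹ totalᴹ (λ x → reciprocal (x ^ e i) *ₗ combination V (λ j → x ^ e j) v)
        V.≈⟨ -ᴹ‿cong (combination-cong {n = N} (λ _ → refl) (λ k → vanishes (from k))) ⟩
      -ᴹ combination V {N} (λ k → reciprocal (from k ^ e i)) (λ _ → 0ᴹ)
        V.≈⟨ -ᴹ‿cong (*ₗ-distrib0 N _) ⟩
      -ᴹ 0ᴹ              V.≈⟨ +ᴹ-inverseʳ-unique 0ᴹ 0ᴹ (+ᴹ-identityˡ 0ᴹ) ⟨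
      0ᴹ                 V.∎
      where
      *ₗ-distrib0 : ∀ m (c : Fin m → Carrier) → combination V c (λ _ → 0ᴹ) ≈ᴹ 0ᴹ
      *ₗ-distrib0 zero    c = ≈ᴹ-refl
      *ₗ-distrib0 (suc m) c = ≈ᴹ-trans (+ᴹ-cong (*ₗ-zeroʳ _) (*ₗ-distrib0 m (c ∘ suc))) (+ᴹ-identityˡ 0ᴹ)

    -- `coefficient` writes each `v i` as a combination of the vectors belonging to the N field
    -- elements; substituting this into the given combination and exchanging the sums produces the
    -- scalars of the witness.
    spanning : (e : Fin n → ℕ) → (∀ i → ℕ.NonZero (e i)) → Distinct e → (v : Fin n → Carrierᴹ) → ∀ a →
               Span V (λ w → ∃ λ x → w ≈ᴹ combination V (λ j → x ^ e j) v) (combination V a v)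
    spanning {n} e e≢0 distinct v a =
      N , (λ k → Sum.sum +-commutativeMonoid (λ i → - a i * r k i)) , (λ k → w k) , (λ k → from k , ≈ᴹ-refl) ,
      ≈ᴹ-sym (V.begin
        sum (λ k → Sum.sum +-commutativeMonoid (λ i → - a i * r k i) *ₗ w k)
          V.≈⟨ sum-cong-≋ {N} (λ k → *ₗ-distribʳ-sum {n} _ (w k)) ⟩
        sum (λ k → sum (λ i → (- a i * r k i) *ₗ w k))
          V.≈⟨ ∑-comm {N} {n} _ ⟩
        sum (λ i → sum (λ k → (- a i * r k i) *ₗ w k))
          V.≈⟨ sum-cong-≋ {n} (λ i → combination-* {N} (- a i) (λ k → r k i) w) ⟩
        sum (λ i → (- a i) *ₗ sum (λ k → r k i *ₗ w k))
          V.≈⟨ sum-cong-≋ {n} (λ i → *ₗ-congˡ (coefficient e e≢0 distinct v i)) ⟩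
        sum (λ i → (- a i) *ₗ (-ᴹ v i))
          V.≈⟨ sum-cong-≋ {n} (λ i → neg-neg (a i) (v i)) ⟩
        combination V a v V.∎)
      where
      w : Fin N → Carrierᴹ
      w k = combination V (λ j → from k ^ e j) v
      r : Fin N → Fin n → Carrier
      r k i = reciprocal (from k ^ e i)
      neg-neg : ∀ c u → (- c) *ₗ (-ᴹ u) ≈ᴹ c *ₗ u
      neg-neg c u = V.begin
        (- c) *ₗ (-ᴹ u)       V.≈⟨ *ₗ-congˡ (≈ᴹ-trans (-‿*ₗ 1# u) (-ᴹ‿cong (*ₗ-identityˡ u))) ⟨
        (- c) *ₗ ((- 1#) *ₗ u) V.≈⟨ *ₗ-assoc (- c) (- 1#) u ⟨
        (- c * - 1#) *ₗ u     V.≈⟨ *ₗ-congʳ (trans (sym (-‿distribˡ-* c (- 1#))) (trans (-‿cong (sym (-‿distribʳ-* c 1#))) (trans (-‿involutive _) (*-identityʳ c)))) ⟩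
        c *ₗ u                V.∎

-- Roots of monic polynomials.

module Roots (K : Field ℓ) where
  open List using (List; []; _∷_; length)
  open FieldProperties K
  open SetoidReasoning setoid
  private module Solver = SemiringSolver commutativeSemiring

  -- The monic polynomial with the given lower coefficients, in increasing degree.
  monic : List Carrier → Carrier → Carrier
  monic []       x = 1#
  monic (c ∷ cs) x = c + x * monic cs x

  -- The lower coefficients of the quotient of monic (c ∷ cs) by X − r, which do
  -- not depend on c.
  quotient : List Carrier → Carrier → List Carrier
  quotient []       r = []
  quotient (c ∷ cs) r = monic (c ∷ cs) r ∷ quotient cs r

  length-quotient : ∀ cs r → length (quotient cs r) ≡ length cs
  length-quotient []       r = ≡.refl
  length-quotient (c ∷ cs) r = ≡.cong suc (length-quotient cs r)

  -- x M(x) − r M(r) = (x − r) Q(x), with the terms moved so that no subtraction occurs.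
  division : ∀ cs r x →
             x * monic cs x + r * monic (quotient cs r) x ≈ r * monic cs r + x * monic (quotient cs r) x
  division []       r x = +-comm _ _
  division (c ∷ cs) r x = begin
    x * (c + x * M) + r * (c + r * M′ + x * Q)
      ≈⟨ solve 6 (λ x r c M M′ Q → x :* (c :+ x :* M) :+ r :* (c :+ r :* M′ :+ x :* Q)
           := x :* c :+ r :* (c :+ r :* M′) :+ x :* (x :* M :+ r :* Q)) refl x r c M M′ Q ⟩
    x * c + r * (c + r * M′) + x * (x * M + r * Q)
      ≈⟨ +-congˡ (*-congˡ (division cs r x)) ⟩
    x * c + r * (c + r * M′) + x * (r * M′ + x * Q)
      ≈⟨ solve 5 (λ x r c M′ Q → x :* c :+ r :* (c :+ r :* M′) :+ x :* (r :* M′ :+ x :* Q)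
           := r :* (c :+ r :* M′) :+ x :* (c :+ r :* M′ :+ x :* Q)) refl x r c M′ Q ⟩
    r * (c + r * M′) + x * (c + r * M′ + x * Q) ∎
    where
    open Solver
    M  = monic cs x
    M′ = monic cs r
    Q  = monic (quotient cs r) x

  -- The factor X - r₀ split off by the first root is nonzero at the other roots, so these are roots
  -- of the quotient, whose degree is one less.
  roots≤degree : ∀ cs {m} (r : Fin m → Carrier) → (∀ i j → r i ≈ r j → i ≡ j) →
                 (∀ i → monic cs (r i) ≈ 0#) → m ℕ.≤ length cs
  roots≤degree cs       {zero}  r inj root = ℕ.z≤n
  roots≤degree []       {suc m} r inj root = contradiction (root zero) 1≉0
  roots≤degree (c ∷ cs) {suc m} r inj root = ℕ.s≤s (≡.subst (m ℕ.≤_) (length-quotient cs r₀)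
    (roots≤degree (quotient cs r₀) (r ∘ suc) (λ i j eq → Fin.suc-injective (inj (suc i) (suc j) eq)) root′))
    where
    r₀ = r zero

    root′ : ∀ i → monic (quotient cs r₀) (r (suc i)) ≈ 0#
    root′ i = *-zero-cancelˡ {x - r₀}
      (λ x-r₀≈0 → contradiction (inj (suc i) zero (x-y≈0⇒x≈y x r₀ x-r₀≈0)) λ ()) (begin
        (x - r₀) * Q     ≈⟨ [y-z]x≈yx-zx Q x r₀ ⟩
        x * Q - r₀ * Q   ≈⟨ x≈y⇒x-y≈0 (sym r₀Q≈xQ) ⟩
        0#               ∎)
      where
      open RingProperties ring using ([y-z]x≈yx-zx)
      x = r (suc i)
      Q = monic (quotient cs r₀) x
      same : x * monic cs x ≈ r₀ * monic cs r₀
      same = +-cancelˡ c _ _ (trans (root (suc i)) (sym (root zero)))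
      r₀Q≈xQ : r₀ * Q ≈ x * Q
      r₀Q≈xQ = +-cancelˡ (x * monic cs x) _ _ (trans (division cs r₀ x) (+-congʳ (sym same)))

  module _ {N} (fin : HasOrder K N) where
    open FiniteSetoid fin

    -- All `N` elements are roots of X ^ m - X. This prevents a proper iterate of the Frobenius map
    -- from being the identity.
    order≤exponent : ∀ m → 2 ℕ.≤ m → (∀ x → x ^ m ≈ x) → N ℕ.≤ m
    order≤exponent (suc (suc m)) (ℕ.s≤s (ℕ.s≤s _)) fixed =
      ≡.subst (λ k → N ℕ.≤ suc (suc k)) (ListProperties.length-replicate m)
      -- These are the lower coefficients of X ^ (m + 2) - X, in increasing degree.
      (roots≤degree (0# ∷ - 1# ∷ List.replicate m 0#) from
        (λ i j eq → ≡.trans (≡.sym (to∘from i)) (≡.trans (to-cong eq) (to∘from j)))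
        (root ∘ from))
      where
      monomial : ∀ k x → monic (List.replicate k 0#) x ≈ x ^ k
      monomial zero    x = refl
      monomial (suc k) x = trans (+-identityˡ _) (*-congˡ (monomial k x))

      root : ∀ x → monic (0# ∷ - 1# ∷ List.replicate m 0#) x ≈ 0#
      root x = begin
        0# + x * (- 1# + x * monic (List.replicate m 0#) x) ≈⟨ +-identityˡ _ ⟩
        x * (- 1# + x * monic (List.replicate m 0#) x)      ≈⟨ *-congˡ (+-congˡ (*-congˡ (monomial m x))) ⟩
        x * (- 1# + x ^ suc m)        ≈⟨ distribˡ _ _ _ ⟩
        x * - 1# + x ^ suc (suc m)    ≈⟨ +-cong (trans (sym (-‿distribʳ-* x 1#)) (-‿cong (*-identityʳ x))) (fixed x) ⟩
        - x + x                       ≈⟨ -‿inverseˡ x ⟩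
        0#                            ∎

-- Binomial coefficients modulo a prime and additivity of powers of the characteristic.

-- The absorption identity, by Pascal's rule. For prime n + 1 it exhibits a product divisible by
-- that prime, one factor of which is the binomial coefficient.
[k+1]*[n+1]C[k+1]≡[n+1]*nCk : ∀ n k → suc k ℕ.* (suc n C suc k) ≡ suc n ℕ.* (n C k)
[k+1]*[n+1]C[k+1]≡[n+1]*nCk zero    zero    = ≡.refl
[k+1]*[n+1]C[k+1]≡[n+1]*nCk zero    (suc k) = begin
  suc (suc k) ℕ.* (1 C suc (suc k)) ≡⟨ ≡.cong (suc (suc k) ℕ.*_) (k>n⇒nCk≡0 {1} {suc (suc k)} (ℕ.s≤s (ℕ.s≤s ℕ.z≤n))) ⟩
  suc (suc k) ℕ.* 0                 ≡⟨ ℕ.*-zeroʳ (suc (suc k)) ⟩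
  0                                 ≡⟨ ≡.cong (ℕ._+ 0) (k>n⇒nCk≡0 {0} {suc k} (ℕ.s≤s ℕ.z≤n)) ⟨
  1 ℕ.* (0 C suc k)                 ∎
  where open ≡.≡-Reasoning
[k+1]*[n+1]C[k+1]≡[n+1]*nCk (suc n) zero    = begin
  1 ℕ.* (suc (suc n) C 1)   ≡⟨ ℕ.*-identityˡ _ ⟩
  suc (suc n) C 1           ≡⟨ nC1≡n (suc (suc n)) ⟩
  suc (suc n)               ≡⟨ ℕ.*-identityʳ (suc (suc n)) ⟨
  suc (suc n) ℕ.* 1         ∎
  where open ≡.≡-Reasoning
[k+1]*[n+1]C[k+1]≡[n+1]*nCk (suc n) (suc k) = begin
  suc (suc k) ℕ.* (suc (suc n) C suc (suc k))
    ≡⟨ ≡.cong (suc (suc k) ℕ.*_) (nCk+nC[k+1]≡[n+1]C[k+1] (suc n) (suc k)) ⟨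
  suc (suc k) ℕ.* (A ℕ.+ B)
    ≡⟨ expand k A B ⟩
  suc k ℕ.* A ℕ.+ A ℕ.+ suc (suc k) ℕ.* B
    ≡⟨ ≡.cong₂ (λ u v → u ℕ.+ A ℕ.+ v) ([k+1]*[n+1]C[k+1]≡[n+1]*nCk n k) ([k+1]*[n+1]C[k+1]≡[n+1]*nCk n (suc k)) ⟩
  suc n ℕ.* (n C k) ℕ.+ A ℕ.+ suc n ℕ.* (n C suc k)
    ≡⟨ collect n (n C k) (n C suc k) A ⟩
  suc n ℕ.* (n C k ℕ.+ n C suc k) ℕ.+ A
    ≡⟨ ≡.cong (λ u → suc n ℕ.* u ℕ.+ A) (nCk+nC[k+1]≡[n+1]C[k+1] n k) ⟩
  suc n ℕ.* A ℕ.+ A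
    ≡⟨ ℕ.+-comm (suc n ℕ.* A) A ⟩
  suc (suc n) ℕ.* A ∎
  where
  open ≡.≡-Reasoning
  A = suc n C suc k
  B = suc n C suc (suc k)
  expand : ∀ k a b → suc (suc k) ℕ.* (a ℕ.+ b) ≡ suc k ℕ.* a ℕ.+ a ℕ.+ suc (suc k) ℕ.* b
  expand = solve-∀
  collect : ∀ n a b c → suc n ℕ.* a ℕ.+ c ℕ.+ suc n ℕ.* b ≡ suc n ℕ.* (a ℕ.+ b) ℕ.+ c
  collect = solve-∀

prime∣binomial : ∀ {p k} → Prime p → suc k ℕ.< p → p ∣ (p C suc k)
prime∣binomial {suc p} {k} pp k<p with euclidsLemma (suc k) (suc p C suc k) pp
  (divides (p C k) (≡.trans ([k+1]*[n+1]C[k+1]≡[n+1]*nCk p k) (ℕ.*-comm (suc p) (p C k))))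
... | inj₁ p∣k = contradiction (∣⇒≤ p∣k) (ℕ.<⇒≱ k<p)
... | inj₂ p∣C = p∣C

module Characteristic (K : Field ℓ) where
  open FieldProperties K
  open Mult semiring using (×-assoc-*; ×-congʳ; ×1-homo-*) renaming (_×_ to _·_)
  open SetoidReasoning setoid

  -- `(r ^ m) · 1#` is the m-th power of `r · 1#`, and a field has no zero divisors.
  power-of-char : ∀ r m → (r ℕ.^ m) · 1# ≈ 0# → (∀ x → Dec (x ≈ 0#)) → r · 1# ≈ 0#
  power-of-char r zero    1≈0 _ = contradiction (trans (sym (+-identityʳ 1#)) 1≈0) 1≉0
  power-of-char r (suc m) rʳ≈0 zero? with zero? (r · 1#)
  ... | yes r≈0 = r≈0
  ... | no  r≉0 = power-of-char r m (*-zero-cancelˡ r≉0 (trans (sym (×1-homo-* r (r ℕ.^ m))) rʳ≈0)) zero?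

  module _ {r : ℕ} (r-prime : Prime r) (r≈0 : r · 1# ≈ 0#) where

    multiple-vanishes : ∀ {m} x → r ∣ m → m · x ≈ 0#
    multiple-vanishes x (divides d ≡.refl) = begin
      (d ℕ.* r) · x            ≈⟨ ×-congʳ (d ℕ.* r) (*-identityˡ x) ⟨
      (d ℕ.* r) · (1# * x)     ≈⟨ ×-assoc-* (d ℕ.* r) 1# x ⟨
      ((d ℕ.* r) · 1#) * x     ≈⟨ *-congʳ (×1-homo-* d r) ⟩
      (d · 1#) * (r · 1#) * x  ≈⟨ *-congʳ (trans (*-congˡ r≈0) (zeroʳ _)) ⟩
      0# * x                   ≈⟨ zeroˡ x ⟩
      0#                       ∎

    -- In the binomial expansion every inner coefficient is divisible by `r`, so only the two
    -- extreme terms survive.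
    ^r-+ : ∀ x y → (x + y) ^ r ≈ x ^ r + y ^ r
    ^r-+ x y = go r ≡.refl
      where
      open Sum +-commutativeMonoid using (sum; sum-init-last; sum-cong-≋; sum-replicate-zero)
      module B = Binomial commutativeSemiring
      go : ∀ m → m ≡ r → (x + y) ^ m ≈ x ^ m + y ^ m
      go zero    ≡.refl = contradiction (prime⇒nonZero r-prime) λ ()
      go (suc m) ≡.refl = begin
        (x + y) ^ suc m                                       ≈⟨ B.theorem (suc m) x y ⟩
        term zero + sum (term ∘ suc)                          ≈⟨ +-congˡ (sum-init-last (term ∘ suc)) ⟩
        term zero + (sum (term ∘ suc ∘ Fin.inject₁) + term (suc (Fin.fromℕ m)))
          ≈⟨ +-cong first (+-cong middle last) ⟩
        y ^ suc m + (0# + x ^ suc m)                          ≈⟨ +-congˡ (+-identityˡ _) ⟩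
        y ^ suc m + x ^ suc m                                 ≈⟨ +-comm _ _ ⟩
        x ^ suc m + y ^ suc m                                 ∎
        where
        term : Fin (suc (suc m)) → Carrier
        term = B.binomialTerm x y (suc m)

        first : term zero ≈ y ^ suc m
        first = trans (+-identityʳ _) (*-identityˡ _)

        middle : sum (term ∘ suc ∘ Fin.inject₁) ≈ 0#
        middle = trans (sum-cong-≋ {m} (λ i → multiple-vanishes _
          (prime∣binomial r-prime (≡.subst (ℕ._< suc m) (≡.cong suc (≡.sym (Fin.toℕ-inject₁ i))) (ℕ.s≤s (Fin.toℕ<n i))))))
          (sum-replicate-zero m)

        last : term (suc (Fin.fromℕ m)) ≈ x ^ suc m
        last rewrite Fin.toℕ-fromℕ m | nCn≡1 (suc m) | ℕ.n∸n≡0 m = trans (+-identityʳ _) (*-identityʳ _)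

    ^r^-+ : ∀ k x y → (x + y) ^ (r ℕ.^ k) ≈ x ^ (r ℕ.^ k) + y ^ (r ℕ.^ k)
    ^r^-+ zero    x y = trans (*-identityʳ _) (+-cong (sym (*-identityʳ x)) (sym (*-identityʳ y)))
    ^r^-+ (suc k) x y = begin
      (x + y) ^ (r ℕ.* r ℕ.^ k)             ≈⟨ ^-assocʳ (x + y) r (r ℕ.^ k) ⟨
      ((x + y) ^ r) ^ (r ℕ.^ k)             ≈⟨ ^-congˡ (r ℕ.^ k) (^r-+ x y) ⟩
      (x ^ r + y ^ r) ^ (r ℕ.^ k)           ≈⟨ ^r^-+ k (x ^ r) (y ^ r) ⟩
      (x ^ r) ^ (r ℕ.^ k) + (y ^ r) ^ (r ℕ.^ k) ≈⟨ +-cong (^-assocʳ x r (r ℕ.^ k)) (^-assocʳ y r (r ℕ.^ k)) ⟩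
      x ^ (r ℕ.* r ℕ.^ k) + y ^ (r ℕ.* r ℕ.^ k) ∎

-- Units modulo t other than ±1.

infix 4 _InvertibleMod_
-- Coprimality in the form needed later: the `s′`-th iterate of φˢ is φ, because φ has period t.
_InvertibleMod_ : ℕ → ℕ → Set
s InvertibleMod t = ∃₂ λ s′ k → s′ ℕ.* s ≡ 1 ℕ.+ k ℕ.* t

halve : ∀ n → ∃[ m ] (n ≡ 2 ℕ.* m ⊎ n ≡ 1 ℕ.+ 2 ℕ.* m)
halve zero    = 0 , inj₁ ≡.refl
halve (suc n) with halve n
... | m , inj₁ ≡.refl = m , inj₂ ≡.refl
... | m , inj₂ ≡.refl = suc m , inj₁ (≡.sym (ℕ.*-suc 2 m))

-- For odd t the unit is 2, for even t the largest odd number below t / 2 that is coprime to t.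
nontrivial-unit : ∀ t → t ≡ 5 ⊎ 6 ℕ.< t → ∃[ s ] 2 ℕ.≤ s × suc s ℕ.< t × s InvertibleMod t
nontrivial-unit _ (inj₁ ≡.refl) = 2 , ℕ.≤ᵇ⇒≤ 2 2 _ , ℕ.≤ᵇ⇒≤ 4 5 _ , 3 , 1 , ≡.refl
nontrivial-unit t (inj₂ t>6) with halve t
... | m , inj₂ ≡.refl = 2 , ℕ.≤-refl , ℕ.≤-trans (ℕ.≤ᵇ⇒≤ 4 7 _) t>6 , suc m , 1 , odd m
  where
  odd : ∀ m → suc m ℕ.* 2 ≡ 1 ℕ.+ 1 ℕ.* (1 ℕ.+ 2 ℕ.* m)
  odd = solve-∀
... | m , inj₁ ≡.refl with halve m
...   | 0 , inj₁ ≡.refl = contradiction t>6 λ ()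
...   | 1 , inj₁ ≡.refl = contradiction (ℕ.<⇒<ᵇ t>6) λ ()
-- Here 4 divides t, and s = t/2 - 1 is its own inverse: s² = 1 + (t/4 - 1) t.
...   | suc (suc j) , inj₁ ≡.refl = 3 ℕ.+ 2 ℕ.* j , ℕ.s≤s (ℕ.s≤s ℕ.z≤n) ,
        ≡.subst (suc (3 ℕ.+ 2 ℕ.* j) ℕ.<_) (bound j) (ℕ.m≤m+n _ _) , 3 ℕ.+ 2 ℕ.* j , 1 ℕ.+ j , unit j
  where
  bound : ∀ j → suc (suc (3 ℕ.+ 2 ℕ.* j)) ℕ.+ (3 ℕ.+ 2 ℕ.* j) ≡ 2 ℕ.* (2 ℕ.* (2 ℕ.+ j))
  bound = solve-∀
  unit : ∀ j → (3 ℕ.+ 2 ℕ.* j) ℕ.* (3 ℕ.+ 2 ℕ.* j) ≡ 1 ℕ.+ (1 ℕ.+ j) ℕ.* (2 ℕ.* (2 ℕ.* (2 ℕ.+ j)))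
  unit = solve-∀
-- Here t/2 is odd and s = t/2 - 2. The formula for its inverse depends on t modulo 8, whence the
-- further halving.
...   | k , inj₂ ≡.refl with halve k
...     | zero , inj₁ ≡.refl = contradiction (ℕ.<⇒<ᵇ t>6) λ ()
...     | suc j , inj₁ ≡.refl = 3 ℕ.+ 4 ℕ.* j , ℕ.s≤s (ℕ.s≤s ℕ.z≤n) ,
          ≡.subst (suc (3 ℕ.+ 4 ℕ.* j) ℕ.<_) (bound j) (ℕ.m≤m+n _ _) , 7 ℕ.+ 6 ℕ.* j , 2 ℕ.+ 3 ℕ.* j , unit j
  where
  bound : ∀ j → suc (suc (3 ℕ.+ 4 ℕ.* j)) ℕ.+ (5 ℕ.+ 4 ℕ.* j) ≡ 2 ℕ.* (1 ℕ.+ 2 ℕ.* (2 ℕ.* (1 ℕ.+ j)))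
  bound = solve-∀
  unit : ∀ j → (7 ℕ.+ 6 ℕ.* j) ℕ.* (3 ℕ.+ 4 ℕ.* j) ≡ 1 ℕ.+ (2 ℕ.+ 3 ℕ.* j) ℕ.* (2 ℕ.* (1 ℕ.+ 2 ℕ.* (2 ℕ.* (1 ℕ.+ j))))
  unit = solve-∀
-- This is t = 6, whose only units are ±1.
...     | zero , inj₂ ≡.refl = contradiction (ℕ.<⇒<ᵇ t>6) λ ()
...     | suc j , inj₂ ≡.refl = 5 ℕ.+ 4 ℕ.* j , ℕ.s≤s (ℕ.s≤s ℕ.z≤n) ,
          ≡.subst (suc (5 ℕ.+ 4 ℕ.* j) ℕ.<_) (bound j) (ℕ.m≤m+n _ _) , 3 ℕ.+ 2 ℕ.* j , 1 ℕ.+ j , unit j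
  where
  bound : ∀ j → suc (suc (5 ℕ.+ 4 ℕ.* j)) ℕ.+ (7 ℕ.+ 4 ℕ.* j) ≡ 2 ℕ.* (1 ℕ.+ 2 ℕ.* (1 ℕ.+ 2 ℕ.* (1 ℕ.+ j)))
  bound = solve-∀
  unit : ∀ j → (3 ℕ.+ 2 ℕ.* j) ℕ.* (5 ℕ.+ 4 ℕ.* j) ≡ 1 ℕ.+ (1 ℕ.+ j) ℕ.* (2 ℕ.* (1 ℕ.+ 2 ℕ.* (1 ℕ.+ 2 ℕ.* (1 ℕ.+ j))))
  unit = solve-∀

-- The Frobenius map: additivity, order and partial norms.

prime-power>1 : ∀ {q} → IsPrimePower q → 1 ℕ.< q
prime-power>1 (r , suc k , r-prime , _ , ≡.refl) =
  ℕ.<-≤-trans (ℕ.nonTrivial⇒n>1 r {{prime⇒nonTrivial r-prime}})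
    (ℕ.m≤m*n r (r ℕ.^ k) {{ℕ.m^n≢0 r k {{prime⇒nonZero r-prime}}}})

module Frobenius (K : Field ℓ) {q t : ℕ} (q-prime-power : IsPrimePower q) (fin : HasOrder K (q ℕ.^ t)) where
  open FieldProperties K
  open FiniteSetoid fin
  open FiniteField K fin using (zero?; N·1≈0; x^N≈x)
  open Characters K fin using (Distinct)
  open Mult semiring using () renaming (_×_ to _·_)
  open SetoidReasoning setoid

  1<q : 1 ℕ.< q
  1<q = prime-power>1 q-prime-power

  instance
    q≢0 : ℕ.NonZero q
    q≢0 = ℕ.>-nonZero (ℕ.<-trans (ℕ.s≤s ℕ.z≤n) 1<q)

  q^≢0 : ∀ i → ℕ.NonZero (q ℕ.^ i)
  q^≢0 i = ℕ.m^n≢0 q i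

  -- The `i`-th iterate of x ↦ x^q, expressed as a single power so that it is one of the characters
  -- treated above.
  φ : ℕ → Carrier → Carrier
  φ i x = x ^ (q ℕ.^ i)

  φ-cong : ∀ i {x y} → x ≈ y → φ i x ≈ φ i y
  φ-cong i = ^-congˡ (q ℕ.^ i)

  φ-* : ∀ i x y → φ i (x * y) ≈ φ i x * φ i y
  φ-* i x y = ^-distrib-* x y (q ℕ.^ i)

  -- The exponent q^i is a power of the prime r underlying q, and r is the characteristic because N
  -- = q^t is a power of r with N · 1 = 0.
  φ-+ : ∀ i x y → φ i (x + y) ≈ φ i x + φ i y
  φ-+ i x y = additive q-prime-power ≡.refl
    where
    open Characteristic K
    additive : IsPrimePower q → ∀ {m} → m ≡ q ℕ.^ i → (x + y) ^ m ≈ x ^ m + y ^ m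
    additive (r , k , r-prime , _ , ≡.refl) ≡.refl
      rewrite ℕ.^-*-assoc r k i = ^r^-+ r-prime r≈0 (k ℕ.* i) x y
      where
      r≈0 : r · 1# ≈ 0#
      r≈0 = power-of-char r (k ℕ.* t) (≡.subst (λ m → m · 1# ≈ 0#) (ℕ.^-*-assoc r k t) N·1≈0) zero?

  φ-1 : ∀ i → φ i 1# ≈ 1#
  φ-1 i = 1^ (q ℕ.^ i)

  φ-0 : ∀ i → φ i 0# ≈ 0#
  φ-0 i = 0^ (q ℕ.^ i) {{q^≢0 i}}

  φ-≉0 : ∀ i {x} → x ≉ 0# → φ i x ≉ 0#
  φ-≉0 i = ^-≉0 (q ℕ.^ i)

  φ-≈0 : ∀ i {x} → φ i x ≈ 0# → x ≈ 0#
  φ-≈0 i {x} φx≈0 with x ≟ 0#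
  ... | yes x≈0 = x≈0
  ... | no  x≉0 = contradiction φx≈0 (φ-≉0 i x≉0)

  φ-neg : ∀ i x → φ i (- x) ≈ - φ i x
  φ-neg i x = +-inverseˡ-unique _ _ (trans (sym (φ-+ i (- x) x)) (trans (φ-cong i (-‿inverseˡ x)) (φ-0 i)))
    where open RingProperties ring using (+-inverseˡ-unique)

  φ-injective : ∀ i {x y} → φ i x ≈ φ i y → x ≈ y
  φ-injective i {x} {y} eq = x-y≈0⇒x≈y x y (φ-≈0 i
    (trans (φ-+ i x (- y)) (trans (+-congˡ (φ-neg i y)) (x≈y⇒x-y≈0 eq))))

  φ-∘ : ∀ i j x → φ i (φ j x) ≈ φ (i ℕ.+ j) x
  φ-∘ i j x = begin
    (x ^ (q ℕ.^ j)) ^ (q ℕ.^ i)  ≈⟨ ^-assocʳ x (q ℕ.^ j) (q ℕ.^ i) ⟩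
    x ^ (q ℕ.^ j ℕ.* q ℕ.^ i)    ≡⟨ ≡.cong (x ^_) (ℕ.^-distribˡ-+-* q j i) ⟨
    φ (j ℕ.+ i) x                ≡⟨ ≡.cong (λ k → φ k x) (ℕ.+-comm j i) ⟩
    φ (i ℕ.+ j) x                ∎

  φ₀ : ∀ x → φ 0 x ≈ x
  φ₀ = *-identityʳ

  φ₁ : ∀ x → φ 1 x ≈ x ^ q
  φ₁ x = reflexive (≡.cong (x ^_) (ℕ.*-identityʳ q))

  φ-+t : ∀ i x → φ (i ℕ.+ t) x ≈ φ i x
  φ-+t i x = trans (sym (φ-∘ i t x)) (φ-cong i (x^N≈x x))

  φ-+kt : ∀ k i x → φ (i ℕ.+ k ℕ.* t) x ≈ φ i x
  φ-+kt zero    i x = reflexive (≡.cong (λ j → φ j x) (ℕ.+-identityʳ i))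
  φ-+kt (suc k) i x = begin
    φ (i ℕ.+ (t ℕ.+ k ℕ.* t)) x  ≡⟨ ≡.cong (λ j → φ j x) (swap i t (k ℕ.* t)) ⟩
    φ (i ℕ.+ k ℕ.* t ℕ.+ t) x    ≈⟨ φ-+t (i ℕ.+ k ℕ.* t) x ⟩
    φ (i ℕ.+ k ℕ.* t) x          ≈⟨ φ-+kt k i x ⟩
    φ i x                        ∎
    where
    swap : ∀ a b c → a ℕ.+ (b ℕ.+ c) ≡ a ℕ.+ c ℕ.+ b
    swap = solve-∀

  φ-fixed : ∀ {x} → φ 1 x ≈ x → ∀ i → φ i x ≈ x
  φ-fixed {x} fixed zero    = φ₀ x
  φ-fixed {x} fixed (suc i) = trans (sym (φ-∘ 1 i x)) (trans (φ-cong 1 (φ-fixed fixed i)) fixed)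

  φ-fixed-multiples : ∀ {s x} → φ s x ≈ x → ∀ i → φ (i ℕ.* s) x ≈ x
  φ-fixed-multiples {s} {x} fixed zero    = φ₀ x
  φ-fixed-multiples {s} {x} fixed (suc i) =
    trans (sym (φ-∘ s (i ℕ.* s) x)) (trans (φ-cong s (φ-fixed-multiples fixed i)) fixed)

  infix 4 _~_
  _~_ : ℕ → ℕ → Set ℓ
  i ~ j = ∀ x → φ i x ≈ φ j x

  ~-* : ∀ {i j} → i ~ j → ∀ m → (m ℕ.* i) ~ (m ℕ.* j)
  ~-* {i} {j} i~j zero    x = refl
  ~-* {i} {j} i~j (suc m) x = begin
    φ (i ℕ.+ m ℕ.* i) x     ≈⟨ φ-∘ i (m ℕ.* i) x ⟨
    φ i (φ (m ℕ.* i) x)     ≈⟨ i~j _ ⟩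
    φ j (φ (m ℕ.* i) x)     ≈⟨ φ-cong j (~-* i~j m x) ⟩
    φ j (φ (m ℕ.* j) x)     ≈⟨ φ-∘ j (m ℕ.* j) x ⟩
    φ (j ℕ.+ m ℕ.* j) x     ∎

  private
    -- By injectivity of `φ i`, agreement would make `φ (j ∸ i)` the identity, and counting roots
    -- would give q^t ≤ q^(j - i).
    ≁-< : ∀ {i j} → i ℕ.< j → j ℕ.< t → ¬ (i ~ j)
    ≁-< {i} {j} i<j j<t i~j =
      ℕ.<⇒≱ (ℕ.^-monoʳ-< q 1<q d<t)
        (Roots.order≤exponent K fin (q ℕ.^ d) 2≤q^d fixed)
      where
      d = j ℕ.∸ i
      d>0 : 0 ℕ.< d
      d>0 = ℕ.m<n⇒0<n∸m i<j
      d<t : d ℕ.< t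
      d<t = ℕ.≤-<-trans (ℕ.m∸n≤m j i) j<t
      2≤q^d : 2 ℕ.≤ q ℕ.^ d
      2≤q^d = ℕ.^-monoʳ-< q 1<q d>0
      fixed : ∀ x → φ d x ≈ x
      fixed x = φ-injective i (begin
        φ i (φ d x)   ≈⟨ φ-∘ i d x ⟩
        φ (i ℕ.+ d) x ≡⟨ ≡.cong (λ k → φ k x) (ℕ.m+[n∸m]≡n (ℕ.<⇒≤ i<j)) ⟩
        φ j x         ≈⟨ i~j x ⟨
        φ i x         ∎)

  ~-unique : ∀ {i j} → i ℕ.< t → j ℕ.< t → i ~ j → i ≡ j
  ~-unique {i} {j} i<t j<t i~j with ℕ.<-cmp i j
  ... | tri≈ _ i≡j _ = i≡j
  ... | tri< i<j _ _ = contradiction i~j (≁-< i<j j<t)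
  ... | tri> _ _ j<i = contradiction (λ x → sym (i~j x)) (≁-< j<i i<t)

  -- Iterating both maps `s′` times undoes the multiplication of the exponents by `s`, up to
  -- multiples of the period t.
  ~-unique-* : ∀ {s i j} → s InvertibleMod t → i ℕ.< t → j ℕ.< t → (i ℕ.* s) ~ (j ℕ.* s) → i ≡ j
  ~-unique-* {s} {i} {j} (s′ , k , s′s≡1+kt) i<t j<t is~js =
    ~-unique i<t j<t (λ x → trans (sym (reduce i x)) (trans (~-* is~js s′ x) (reduce j x)))
    where
    reduce : ∀ i x → φ (s′ ℕ.* (i ℕ.* s)) x ≈ φ i x
    reduce i x = begin
      φ (s′ ℕ.* (i ℕ.* s)) x          ≡⟨ ≡.cong (λ m → φ m x) exponent ⟩
      φ (i ℕ.+ (i ℕ.* k) ℕ.* t) x     ≈⟨ φ-+kt (i ℕ.* k) i x ⟩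
      φ i x                           ∎
      where
      rearrange₁ : ∀ a b c → a ℕ.* (b ℕ.* c) ≡ b ℕ.* (a ℕ.* c)
      rearrange₁ = solve-∀
      rearrange₂ : ∀ i k t → i ℕ.* (1 ℕ.+ k ℕ.* t) ≡ i ℕ.+ (i ℕ.* k) ℕ.* t
      rearrange₂ = solve-∀
      exponent : s′ ℕ.* (i ℕ.* s) ≡ i ℕ.+ (i ℕ.* k) ℕ.* t
      exponent = ≡.trans (rearrange₁ s′ i s) (≡.trans (≡.cong (i ℕ.*_) s′s≡1+kt) (rearrange₂ i k t))

  distinct-powers : (e : Fin n → ℕ) → (∀ i → e i ℕ.< t) → (∀ i j → e i ≡ e j → i ≡ j) → Distinct (λ i → q ℕ.^ e i)
  distinct-powers e e<t e-inj i j i≢j agree = i≢j (e-inj i j (~-unique (e<t i) (e<t j) agree))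

  distinct-multiples : ∀ {s} → s InvertibleMod t → Distinct (λ (i : Fin t) → q ℕ.^ (Fin.toℕ i ℕ.* s))
  distinct-multiples inv i j i≢j agree =
    i≢j (Fin.toℕ-injective (~-unique-* inv (Fin.toℕ<n i) (Fin.toℕ<n j) agree))

  -- The product of φ^{si}(x) over i < m, that is, the element y of the overview.
  norm : ℕ → ℕ → Carrier → Carrier
  norm s zero    x = 1#
  norm s (suc m) x = x * φ s (norm s m x)

  norm-≉0 : ∀ s m {x} → x ≉ 0# → norm s m x ≉ 0#
  norm-≉0 s zero    x≉0 = 1≉0
  norm-≉0 s (suc m) x≉0 = *-≉0 x≉0 (φ-≉0 s (norm-≉0 s m x≉0))

  -- Applying φˢ shifts the factors of the product by one: x leaves and φ^{ms}(x) enters. The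
  -- quotients are cross-multiplied.
  φ-norm : ∀ s m x → φ s (norm s m x) * x ≈ norm s m x * φ (m ℕ.* s) x
  φ-norm s zero    x = *-cong (φ-1 s) (sym (φ₀ x))
  φ-norm s (suc m) x = begin
    φ s (x * φ s ν) * x             ≈⟨ *-congʳ (trans (φ-* s x (φ s ν)) (*-comm _ _)) ⟩
    φ s (φ s ν) * φ s x * x         ≈⟨ *-congʳ (φ-* s (φ s ν) x) ⟨
    φ s (φ s ν * x) * x             ≈⟨ *-congʳ (φ-cong s (φ-norm s m x)) ⟩
    φ s (ν * φ (m ℕ.* s) x) * x     ≈⟨ *-congʳ (trans (φ-* s ν _) (*-congˡ (φ-∘ s (m ℕ.* s) x))) ⟩
    φ s ν * φ (s ℕ.+ m ℕ.* s) x * x ≈⟨ trans (*-comm _ x) (sym (*-assoc x _ _)) ⟩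
    x * φ s ν * φ (s ℕ.+ m ℕ.* s) x ∎
    where ν = norm s m x

  module _ {s : ℕ} (inv : s InvertibleMod t) where

    -- The product of s factors for φ itself: it replaces φˢ(x)/x by φ(y)/y. The exponent `1 ℕ.* s`
    -- is the one that `conjugates` has at index 1.
    line⊆ : ∀ {x} → x ≉ 0# → ∃[ y ] y ≉ 0# × φ 1 y * x ≈ y * φ (1 ℕ.* s) x
    line⊆ {x} x≉0 = norm 1 s x , norm-≉0 1 s x≉0 , trans (φ-norm 1 s x)
      (*-congˡ (reflexive (≡.cong (λ i → φ i x) (≡.trans (ℕ.*-identityʳ s) (≡.sym (ℕ.*-identityˡ s))))))

    -- The opposite direction takes `s′` factors for φˢ, and φ^{s′s} = φ.
    line⊇ : ∀ {x} → x ≉ 0# → ∃[ y ] y ≉ 0# × φ (1 ℕ.* s) y * x ≈ y * φ 1 x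
    line⊇ {x} x≉0 = let (s′ , k , s′s≡1+kt) = inv in
      norm s s′ x , norm-≉0 s s′ x≉0 , (begin
        φ (1 ℕ.* s) (norm s s′ x) * x   ≡⟨ ≡.cong (λ i → φ i (norm s s′ x) * x) (ℕ.*-identityˡ s) ⟩
        φ s (norm s s′ x) * x           ≈⟨ φ-norm s s′ x ⟩
        norm s s′ x * φ (s′ ℕ.* s) x    ≡⟨ ≡.cong (λ i → norm s s′ x * φ i x) s′s≡1+kt ⟩
        norm s s′ x * φ (1 ℕ.+ k ℕ.* t) x ≈⟨ *-congˡ (φ-+kt k 1 x) ⟩
        norm s s′ x * φ 1 x             ∎)

open Vector using ([]; _∷_)

-- Extension of independent families to bases, by counting.

^-injectiveʳ : ∀ {b m n} → 1 ℕ.< b → b ℕ.^ m ≡ b ℕ.^ n → m ≡ n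
^-injectiveʳ {b} {m} {n} 1<b eq with ℕ.<-cmp m n
... | tri≈ _ m≡n _ = m≡n
... | tri< m<n _ _ = contradiction eq (ℕ.<⇒≢ (ℕ.^-monoʳ-< b 1<b m<n))
... | tri> _ _ n<m = contradiction (≡.sym eq) (ℕ.<⇒≢ (ℕ.^-monoʳ-< b 1<b n<m))

module BasisExtension (K : Field ℓ) {N : ℕ} (fin : HasOrder K N) (V : VectorSpace K) where
  open FieldProperties K
  open FiniteSetoid fin using (_≟_)
  open FiniteField K fin using (1<N)
  open Combinations V
  open SetoidReasoning ≈ᴹ-setoid
  open CommutativeSemigroupProperties (CommutativeMonoid.commutativeSemigroup +ᴹ-commutativeMonoid)
    using () renaming (interchange to +ᴹ-interchange; x∙yz≈y∙xz to u+vw≈v+uw)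


  -- The two families stand for their concatenation: the first stays fixed while the second grows.
  Independent : (Fin m → Carrierᴹ) → (Fin n → Carrierᴹ) → Set ℓ
  Independent b c = ∀ α β → combination V α b +ᴹ combination V β c ≈ᴹ 0ᴹ →
                    (∀ i → α i ≈ 0#) × (∀ j → β j ≈ 0#)

  InSpan : (Fin m → Carrierᴹ) → (Fin n → Carrierᴹ) → Carrierᴹ → Set ℓ
  InSpan {m} {n} b c v = Σ ((Fin m → Carrier) × (Fin n → Carrier)) λ (α , β) → v ≈ᴹ combination V α b +ᴹ combination V β c

  coordinates-unique : {b : Fin m → Carrierᴹ} {c : Fin n → Carrierᴹ} → Independent b c → ∀ {α α′ β β′} →
    combination V α b +ᴹ combination V β c ≈ᴹ combination V α′ b +ᴹ combination V β′ c →
    (∀ i → α i ≈ α′ i) × (∀ j → β j ≈ β′ j)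
  coordinates-unique {b = b} {c} indep {α} {α′} {β} {β′} eq =
    (λ i → x-y≈0⇒x≈y _ _ (proj₁ vanish i)) , (λ j → x-y≈0⇒x≈y _ _ (proj₂ vanish j))
    where
    A = combination V α b
    B = combination V β c
    A′ = combination V α′ b
    B′ = combination V β′ c
    vanish = indep (λ i → α i - α′ i) (λ j → β j - β′ j) (begin
      combination V (λ i → α i - α′ i) b +ᴹ combination V (λ j → β j - β′ j) c
        ≈⟨ +ᴹ-cong (combination-+ α (λ i → - α′ i) b) (combination-+ β (λ j → - β′ j) c) ⟩
      (A +ᴹ combination V (λ i → - α′ i) b) +ᴹ (B +ᴹ combination V (λ j → - β′ j) c)
        ≈⟨ +ᴹ-interchange _ _ _ _ ⟩
      (A +ᴹ B) +ᴹ (combination V (λ i → - α′ i) b +ᴹ combination V (λ j → - β′ j) c)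
        ≈⟨ +ᴹ-cong eq (+ᴹ-cong (combination-neg α′ b) (combination-neg β′ c)) ⟩
      (A′ +ᴹ B′) +ᴹ (-ᴹ A′ +ᴹ -ᴹ B′)
        ≈⟨ +ᴹ-interchange _ _ _ _ ⟩
      (A′ +ᴹ -ᴹ A′) +ᴹ (B′ +ᴹ -ᴹ B′)
        ≈⟨ +ᴹ-cong (-ᴹ‿inverseʳ A′) (-ᴹ‿inverseʳ B′) ⟩
      0ᴹ +ᴹ 0ᴹ
        ≈⟨ +ᴹ-identityˡ 0ᴹ ⟩
      0ᴹ ∎)

  -- The coordinate bijection turns a comparison of dimensions into one of cardinalities.
  coordinates-finite : {b : Fin m → Carrierᴹ} {c : Fin n → Carrierᴹ} → Independent b c → (∀ v → InSpan b c v) →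
                       Inverse (×-setoid (≋-setoid setoid m) (≋-setoid setoid n)) ≈ᴹ-setoid
  coordinates-finite {b = b} {c} indep spans = record
    { to        = λ (α , β) → combination V α b +ᴹ combination V β c
    ; from      = λ v → proj₁ (spans v)
    ; to-cong   = λ (α≈ , β≈) → +ᴹ-cong (combination-congˡ b α≈) (combination-congˡ c β≈)
    ; from-cong = λ {u} {v} u≈v → coordinates-unique indep
        (≈ᴹ-trans (≈ᴹ-sym (proj₂ (spans u))) (≈ᴹ-trans u≈v (proj₂ (spans v))))
    ; inverse   =
        (λ {v} (α≈ , β≈) → ≈ᴹ-trans (+ᴹ-cong (combination-congˡ b α≈) (combination-congˡ c β≈)) (≈ᴹ-sym (proj₂ (spans v))))
      , (λ {_} {v} v≈ → coordinates-unique indep (≈ᴹ-trans (≈ᴹ-sym (proj₂ (spans v))) v≈))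
    }

  private
    coefficients-finite : ∀ m n → Finite (×-setoid (≋-setoid setoid m) (≋-setoid setoid n)) (N ℕ.^ m ℕ.* N ℕ.^ n)
    coefficients-finite m n = ×-finite (functions-finite fin m) (functions-finite fin n)

  space-finite : ∀ {t} → HasDim V U t → Finite ≈ᴹ-setoid (N ℕ.^ t)
  space-finite {t} (b , _ , indep , spans) = ≡.subst (Finite ≈ᴹ-setoid) (ℕ.*-identityˡ _)
    (Composition.inverse
      (Symmetry.inverse (coordinates-finite {b = λ ()} {b}
        (λ α β eq → (λ ()) , indep β (≈ᴹ-trans (≈ᴹ-sym (+ᴹ-identityˡ _)) eq))
        (λ v → ((λ ()) , proj₁ (spans {v} _)) , ≈ᴹ-trans (proj₂ (spans {v} _)) (≈ᴹ-sym (+ᴹ-identityˡ _)))))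
      (coefficients-finite 0 t))

  module _ {t : ℕ} (finV : Finite ≈ᴹ-setoid (N ℕ.^ t)) where
    private module FV = FiniteSetoid finV

    inSpan? : (b : Fin m → Carrierᴹ) (c : Fin n → Carrierᴹ) → ∀ v → Dec (InSpan b c v)
    inSpan? {m} {n} b c v = FiniteSetoid.search (coefficients-finite m n)
      (λ (α≈ , β≈) v≈ → ≈ᴹ-trans v≈ (+ᴹ-cong (combination-congˡ b α≈) (combination-congˡ c β≈)))
      (λ (α , β) → v FV.≟ combination V α b +ᴹ combination V β c)

    adjoin : {b : Fin m → Carrierᴹ} {c : Fin n → Carrierᴹ} {v : Carrierᴹ} →
             Independent b c → ¬ InSpan b c v → Independent b (v ∷ c)
    adjoin {b = b} {c} {v} indep v∉ α β eq with β zero ≟ 0#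
    ... | yes β₀≈0 = proj₁ vanish , λ { zero → β₀≈0 ; (suc j) → proj₂ vanish j }
      where
      A = combination V α b
      B = combination V (β ∘ suc) c
      vanish = indep α (β ∘ suc) (begin
        A +ᴹ B                       ≈⟨ +ᴹ-congˡ (+ᴹ-identityˡ B) ⟨
        A +ᴹ (0ᴹ +ᴹ B)               ≈⟨ +ᴹ-congˡ (+ᴹ-congʳ (≈ᴹ-trans (*ₗ-congʳ β₀≈0) (*ₗ-zeroˡ v))) ⟨
        A +ᴹ (β zero *ₗ v +ᴹ B)      ≈⟨ eq ⟩
        0ᴹ                           ∎)
    ... | no  β₀≉0 = contradiction (((λ i → d * α i) , (λ j → d * β (suc j))) , ≈ᴹ-sym (begin
        combination V (λ i → d * α i) b +ᴹ combination V (λ j → d * β (suc j)) c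
          ≈⟨ +ᴹ-cong (combination-* d α b) (combination-* d (β ∘ suc) c) ⟩
        d *ₗ A +ᴹ d *ₗ B             ≈⟨ *ₗ-distribˡ d A B ⟨
        d *ₗ (A +ᴹ B)                ≈⟨ *ₗ-congˡ (+ᴹ-inverseʳ-unique _ _ (≈ᴹ-trans (u+vw≈v+uw _ A B) eq)) ⟩
        d *ₗ (-ᴹ (β zero *ₗ v))      ≈⟨ *ₗ-congˡ (-‿*ₗ (β zero) v) ⟨
        d *ₗ ((- β zero) *ₗ v)       ≈⟨ *ₗ-assoc d (- β zero) v ⟨
        (d * - β zero) *ₗ v          ≈⟨ *ₗ-congʳ (trans (*-comm d (- β zero)) -β₀d≈1) ⟩
        1# *ₗ v                      ≈⟨ *ₗ-identityˡ v ⟩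
        v                            ∎)) v∉
      where
      A = combination V α b
      B = combination V (β ∘ suc) c
      invertible = inverse {x = - β zero} (λ -β₀≈0 → β₀≉0 (trans (sym (-‿involutive _)) (trans (-‿cong -β₀≈0) -0#≈0#)))
      d = proj₁ invertible
      -β₀d≈1 = proj₂ invertible

    weaken : {b : Fin m → Carrierᴹ} {c : Fin n → Carrierᴹ} (v : Carrierᴹ) {u : Carrierᴹ} → InSpan b c u → InSpan b (v ∷ c) u
    weaken v ((α , β) , u≈) = (α , 0# ∷ β) ,
      ≈ᴹ-trans u≈ (+ᴹ-congˡ (≈ᴹ-sym (≈ᴹ-trans (+ᴹ-congʳ (*ₗ-zeroˡ v)) (+ᴹ-identityˡ _))))

    newest : {b : Fin m → Carrierᴹ} {c : Fin n → Carrierᴹ} {v : Carrierᴹ} → InSpan b (v ∷ c) v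
    newest {b = b} {c} {v} = ((λ _ → 0#) , 1# ∷ λ _ → 0#) , ≈ᴹ-sym (begin
      combination V (λ _ → 0#) b +ᴹ (1# *ₗ v +ᴹ combination V (λ _ → 0#) c)
        ≈⟨ +ᴹ-cong (combination-0 b (λ _ → refl)) (+ᴹ-cong (*ₗ-identityˡ v) (combination-0 c (λ _ → refl))) ⟩
      0ᴹ +ᴹ (v +ᴹ 0ᴹ)  ≈⟨ +ᴹ-identityˡ _ ⟩
      v +ᴹ 0ᴹ          ≈⟨ +ᴹ-identityʳ v ⟩
      v                ∎)

    private
      -- Goes through `vs` and adjoins each vector that the families built so far do not span, so
      -- that `b` itself is never changed.
      absorb : ∀ {k} (b : Fin m → Carrierᴹ) → LinearlyIndependent V b → (vs : Fin k → Carrierᴹ) →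
               ∃₂ λ n (c : Fin n → Carrierᴹ) → Independent b c × (∀ i → InSpan b c (vs i))
      absorb {k = zero} b indep vs =
        0 , (λ ()) , (λ α β eq → indep α (≈ᴹ-trans (≈ᴹ-sym (+ᴹ-identityʳ _)) eq) , λ ()) , λ ()
      absorb {k = suc k} b indep vs with absorb b indep (vs ∘ suc)
      ... | n , c , indep₂ , spans with inSpan? b c (vs zero)
      ...   | yes v∈ = n , c , indep₂ , λ { zero → v∈ ; (suc i) → spans i }
      ...   | no  v∉ = suc n , vs zero ∷ c , adjoin indep₂ v∉ , λ { zero → newest ; (suc i) → weaken (vs zero) (spans i) }

    -- Absorbing an enumeration of the whole space yields a basis. Its size follows from N^(m + n) =
    -- N^t, so no exchange argument is needed.
    extend : (b : Fin m → Carrierᴹ) → LinearlyIndependent V b →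
             ∃₂ λ n (c : Fin n → Carrierᴹ) → m ℕ.+ n ≡ t × Independent b c × (∀ v → InSpan b c v)
    extend {m} b indep with absorb b indep FV.from
    ... | n , c , indep₂ , spans = n , c , count , indep₂ , spans′
      where
      spans′ : ∀ v → InSpan b c v
      spans′ v = let (αβ , v≈) = spans (FV.to v) in αβ , ≈ᴹ-trans (≈ᴹ-sym (FV.from∘to v)) v≈
      count : m ℕ.+ n ≡ t
      count = ^-injectiveʳ 1<N (≡.trans (ℕ.^-distribˡ-+-* N m n)
        (finite-unique (coefficients-finite m n) finV (coordinates-finite indep₂ spans′)))

    -- Applied to K as a space over F, where the cardinality q^t gives the dimension t.
    basis : HasDim V U t
    basis with extend {0} (λ ()) (λ _ _ ())
    ... | n , c , ≡.refl , indep , spans = c , _ , (λ a eq → proj₂ (indep (λ ()) a (≈ᴹ-trans (+ᴹ-identityˡ _) eq))) ,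
      λ {v} _ → let ((_ , β) , v≈) = spans v in β , ≈ᴹ-trans v≈ (+ᴹ-identityˡ _)

-- Points, their generators and their images.

≐-trans : {A : Set ℓ} {P : Pred A ℓ₁} {Q : Pred A ℓ₂} {R : Pred A ℓ₃} → P ≐ Q → Q ≐ R → P ≐ R
≐-trans (P⊆Q , Q⊆P) (Q⊆R , R⊆Q) = (λ p → Q⊆R (P⊆Q p)) , (λ r → Q⊆P (R⊆Q r))

≐-sym : {A : Set ℓ} {P : Pred A ℓ₁} {Q : Pred A ℓ₂} → P ≐ Q → Q ≐ P
≐-sym (P⊆Q , Q⊆P) = Q⊆P , P⊆Q

≐-refl : {A : Set ℓ} {P : Pred A ℓ₁} → P ≐ P
≐-refl = id , id

module Points (K : Field ℓ) (V : VectorSpace K) where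
  open FieldProperties K
  open Combinations V
  open SetoidReasoning ≈ᴹ-setoid

  *ₗ-zero-cancelˡ : ∀ {c v} → c ≉ 0# → c *ₗ v ≈ᴹ 0ᴹ → v ≈ᴹ 0ᴹ
  *ₗ-zero-cancelˡ {c} {v} c≉0 cv≈0 = let (d , cd≈1) = inverse c≉0 in begin
    v               ≈⟨ *ₗ-identityˡ v ⟨
    1# *ₗ v         ≈⟨ *ₗ-congʳ (trans (*-comm d c) cd≈1) ⟨
    (d * c) *ₗ v    ≈⟨ *ₗ-assoc d c v ⟩
    d *ₗ (c *ₗ v)   ≈⟨ *ₗ-congˡ cv≈0 ⟩
    d *ₗ 0ᴹ         ≈⟨ *ₗ-zeroʳ d ⟩
    0ᴹ              ∎

  ⟨⟩-subspace : Carrierᴹ → Subspace V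
  ⟨⟩-subspace v = record
    { Member    = ⟨_⟩ V v
    ; resp      = λ u≈u′ (c , u≈cv) → c , ≈ᴹ-trans (≈ᴹ-sym u≈u′) u≈cv
    ; 0-closed  = 0# , ≈ᴹ-sym (*ₗ-zeroˡ v)
    ; +-closed  = λ (c , u≈) (d , u′≈) → c + d , ≈ᴹ-trans (+ᴹ-cong u≈ u′≈) (≈ᴹ-sym (*ₗ-distribʳ v c d))
    ; *ₗ-closed = λ k (c , u≈) → k * c , ≈ᴹ-trans (*ₗ-congˡ u≈) (≈ᴹ-sym (*ₗ-assoc k c v))
    }

  singleton : ∀ (a : Fin 1 → Carrier) (b : Fin 1 → Carrierᴹ) → combination V a b ≈ᴹ a zero *ₗ b zero
  singleton a b = +ᴹ-identityʳ _

  scalar-zero : ∀ {c v} → Dec (c ≈ 0#) → v ≉ᴹ 0ᴹ → c *ₗ v ≈ᴹ 0ᴹ → c ≈ 0#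
  scalar-zero (yes c≈0) v≉0 cv≈0 = c≈0
  scalar-zero (no  c≉0) v≉0 cv≈0 = contradiction (*ₗ-zero-cancelˡ c≉0 cv≈0) v≉0

  module _ (zero? : ∀ c → Dec (c ≈ 0#)) where

    point : ∀ {v} → v ≉ᴹ 0ᴹ → Point V
    point {v} v≉0 = record
      { subspace = ⟨⟩-subspace v
      ; dim≡1    = (λ _ → v) , (λ _ → 1# , ≈ᴹ-sym (*ₗ-identityˡ v))
                 , (λ { a av≈0 zero → scalar-zero (zero? (a zero)) v≉0 (≈ᴹ-trans (≈ᴹ-sym (singleton a (λ _ → v))) av≈0) })
                 , (λ (c , u≈) → (λ _ → c) , ≈ᴹ-trans u≈ (≈ᴹ-sym (singleton (λ _ → c) (λ _ → v))))
      }

  generator : (P : Point V) → ∃[ v ] v ≉ᴹ 0ᴹ × v ∈ ⟦ P ⟧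
  generator P = let (b , b∈ , indep , _) = Point.dim≡1 P in
    b zero , (λ b≈0 → 1≉0 (indep (λ _ → 1#) (≈ᴹ-trans (singleton (λ _ → 1#) b) (≈ᴹ-trans (*ₗ-congˡ b≈0) (*ₗ-zeroʳ 1#))) zero))
    , b∈ zero

  self∈⟨⟩ : ∀ v → v ∈ ⟨_⟩ V v
  self∈⟨⟩ v = 1# , ≈ᴹ-sym (*ₗ-identityˡ v)

  ⟨⟩-cong : ∀ {u v} → u ≈ᴹ v → ⟨_⟩ V u ≐ ⟨_⟩ V v
  ⟨⟩-cong u≈v = (λ (c , x≈) → c , ≈ᴹ-trans x≈ (*ₗ-congˡ u≈v))
              , (λ (c , x≈) → c , ≈ᴹ-trans x≈ (*ₗ-congˡ (≈ᴹ-sym u≈v)))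

  ⟨⟩-scale : ∀ {c u v} → c ≉ 0# → u ≈ᴹ c *ₗ v → ⟨_⟩ V u ≐ ⟨_⟩ V v
  ⟨⟩-scale {c} {u} {v} c≉0 u≈cv =
      (λ (k , x≈) → k * c , ≈ᴹ-trans x≈ (≈ᴹ-trans (*ₗ-congˡ u≈cv) (≈ᴹ-sym (*ₗ-assoc k c v))))
    , (λ (k , x≈) → k * d , ≈ᴹ-trans x≈ (begin
        k *ₗ v                  ≈⟨ *ₗ-congˡ (*ₗ-identityˡ v) ⟨
        k *ₗ (1# *ₗ v)          ≈⟨ *ₗ-congˡ (*ₗ-congʳ (trans (*-comm d c) cd≈1)) ⟨
        k *ₗ ((d * c) *ₗ v)     ≈⟨ *ₗ-congˡ (*ₗ-assoc d c v) ⟩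
        k *ₗ (d *ₗ (c *ₗ v))    ≈⟨ *ₗ-assoc k d (c *ₗ v) ⟨
        (k * d) *ₗ (c *ₗ v)     ≈⟨ *ₗ-congˡ u≈cv ⟨
        (k * d) *ₗ u            ∎))
    where
    d = proj₁ (inverse c≉0)
    cd≈1 = proj₂ (inverse c≉0)

  ⟨⟩-proportional : ∀ {a b u v} → a ≉ 0# → b ≉ 0# → a *ₗ u ≈ᴹ b *ₗ v → ⟨_⟩ V u ≐ ⟨_⟩ V v
  ⟨⟩-proportional a≉0 b≉0 au≈bv = ≐-trans (≐-sym (⟨⟩-scale a≉0 ≈ᴹ-refl)) (⟨⟩-scale b≉0 au≈bv)

module _ (K : Field ℓ) (V V′ : VectorSpace K) where
  open FieldProperties K
  private
    module V = LeftModule V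
    module V′ = LeftModule V′

  imageᵛ-cong : (f : V.Carrierᴹ → V′.Carrierᴹ) {S T : Pred V.Carrierᴹ ℓ} → S ≐ T → imageᵛ V V′ f S ≐ imageᵛ V V′ f T
  imageᵛ-cong f (S⊆T , T⊆S) = (λ (v , v∈ , u≈) → v , S⊆T v∈ , u≈) , (λ (v , v∈ , u≈) → v , T⊆S v∈ , u≈)

  -- Surjectivity of `σ` makes the image a full one-dimensional subspace; linear maps are covered by
  -- the identity for `σ`.
  imageᵛ-⟨⟩ : (f : V.Carrierᴹ → V′.Carrierᴹ) (σ : Carrier → Carrier) →
    (∀ {u v} → u V.≈ᴹ v → f u V′.≈ᴹ f v) → (∀ c v → f (c V.*ₗ v) V′.≈ᴹ σ c V′.*ₗ f v) → (∀ d → ∃[ c ] σ c ≈ d) →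
    ∀ v → imageᵛ V V′ f (⟨_⟩ V v) ≐ ⟨_⟩ V′ (f v)
  imageᵛ-⟨⟩ f σ f-cong f-* σ-surj v =
      (λ (u , (c , u≈cv) , x≈fu) → σ c , V′.≈ᴹ-trans x≈fu (V′.≈ᴹ-trans (f-cong u≈cv) (f-* c v)))
    , (λ (d , x≈) → let (c , σc≈d) = σ-surj d in
         c V.*ₗ v , (c , V.≈ᴹ-refl) , V′.≈ᴹ-trans x≈ (V′.≈ᴹ-trans (V′.*ₗ-congʳ (sym σc≈d)) (V′.≈ᴹ-sym (f-* c v))))

-- Embedded scalars and coordinates with respect to a basis.

module Embedding {F K : Field ℓ} (ι : FieldExtension F K) where
  private
    module F = FieldProperties F
    module K = FieldProperties K
  open FieldExtension ι

  embed-^ : ∀ a n → embed (a F.^ n) K.≈ embed a K.^ n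
  embed-^ a zero    = 1#-homo
  embed-^ a (suc n) = K.trans (*-homo a (a F.^ n)) (K.*-congˡ (embed-^ a n))

module Frame (K : Field ℓ) (V : VectorSpace K) (e : Fin n → LeftModule.Carrierᴹ V)
  (indep : LinearlyIndependent V e) (spans : ∀ v → ∃[ a ] LeftModule._≈ᴹ_ V v (combination V a e)) where
  open FieldProperties K
  open Combinations V

  coord : Carrierᴹ → Fin n → Carrier
  coord v = proj₁ (spans v)

  coord-≈ : ∀ {v a} → v ≈ᴹ combination V a e → ∀ i → coord v i ≈ a i
  coord-≈ {v} {a} v≈ i = x-y≈0⇒x≈y _ _ (indep (λ i → coord v i - a i) (≈ᴹ-trans
    (combination-+ (coord v) (λ i → - a i) e)
    (≈ᴹ-trans (+ᴹ-cong (≈ᴹ-trans (≈ᴹ-sym (proj₂ (spans v))) v≈) (combination-neg a e)) (-ᴹ‿inverseʳ _))) i)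

  coord-cong : ∀ {u v} → u ≈ᴹ v → ∀ i → coord u i ≈ coord v i
  coord-cong {u} {v} u≈v = coord-≈ (≈ᴹ-trans u≈v (proj₂ (spans v)))

  coord-+ : ∀ u v i → coord (u +ᴹ v) i ≈ coord u i + coord v i
  coord-+ u v = coord-≈ (≈ᴹ-trans (+ᴹ-cong (proj₂ (spans u)) (proj₂ (spans v)))
    (≈ᴹ-sym (combination-+ (coord u) (coord v) e)))

  coord-* : ∀ c v i → coord (c *ₗ v) i ≈ c * coord v i
  coord-* c v = coord-≈ (≈ᴹ-trans (*ₗ-congˡ (proj₂ (spans v))) (≈ᴹ-sym (combination-* c (coord v) e)))

  coord-injective : ∀ {u v} → (∀ i → coord u i ≈ coord v i) → u ≈ᴹ v
  coord-injective {u} {v} eq =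
    ≈ᴹ-trans (proj₂ (spans u)) (≈ᴹ-trans (combination-congˡ e eq) (≈ᴹ-sym (proj₂ (spans v))))

-- The centre, the subgeometries and their projections.

module Construction {q n : ℕ} (q-prime-power : IsPrimePower q) {F K : Field ℓ}
  (finF : HasOrder F q) (finK : HasOrder K (q ℕ.^ (2 ℕ.+ n))) (ι : FieldExtension F K) (V : VectorSpace K)
  (u₀ u₁ : LeftModule.Carrierᴹ V) (c : Fin n → LeftModule.Carrierᴹ V)
  (indep : LinearlyIndependent V (u₀ ∷ u₁ ∷ c))
  (spans : ∀ v → ∃[ a ] LeftModule._≈ᴹ_ V v (combination V a (u₀ ∷ u₁ ∷ c))) where

  open FieldProperties K
  open FiniteSetoid finK using (_≟_)
  open FiniteField K finK using (zero?)
  open Frobenius K {q} {2 ℕ.+ n} q-prime-power finK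
  open Characters K finK using (spanning)
  open Combinations V
  open Points K V
  open FieldExtension ι using (embed)
  open SetoidReasoning ≈ᴹ-setoid

  t : ℕ
  t = 2 ℕ.+ n

  e : Fin t → Carrierᴹ
  e = u₀ ∷ u₁ ∷ c

  open Frame K V e indep spans public

  Γ : Subspace V
  Γ = record
    { Member    = λ v → ∃[ β ] v ≈ᴹ combination V β c
    ; resp      = λ u≈v (β , u≈) → β , ≈ᴹ-trans (≈ᴹ-sym u≈v) u≈
    ; 0-closed  = (λ _ → 0#) , ≈ᴹ-sym (combination-0 c (λ _ → refl))
    ; +-closed  = λ (β , u≈) (β′ , v≈) → (λ j → β j + β′ j) , ≈ᴹ-trans (+ᴹ-cong u≈ v≈) (≈ᴹ-sym (combination-+ β β′ c))
    ; *ₗ-closed = λ k (β , u≈) → (λ j → k * β j) , ≈ᴹ-trans (*ₗ-congˡ u≈) (≈ᴹ-sym (combination-* k β c))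
    }

  pad : (β : Fin n → Carrier) → combination V (0# ∷ 0# ∷ β) e ≈ᴹ combination V β c
  pad β = ≈ᴹ-trans (+ᴹ-cong (*ₗ-zeroˡ u₀) (≈ᴹ-trans (+ᴹ-congʳ (*ₗ-zeroˡ u₁)) (+ᴹ-identityˡ _))) (+ᴹ-identityˡ _)

  Γ⇒coord₀ : ∀ v → v ∈ Member Γ → coord v zero ≈ 0#
  Γ⇒coord₀ v (β , v≈) = coord-≈ {v} {0# ∷ 0# ∷ β} (≈ᴹ-trans v≈ (≈ᴹ-sym (pad β))) zero

  Γ⇒coord₁ : ∀ v → v ∈ Member Γ → coord v (suc zero) ≈ 0#
  Γ⇒coord₁ v (β , v≈) = coord-≈ {v} {0# ∷ 0# ∷ β} (≈ᴹ-trans v≈ (≈ᴹ-sym (pad β))) (suc zero)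

  Γ-dim : HasDim V (Member Γ) n
  Γ-dim = c , (λ j → unit j , c∈ j) , (λ β β≈0 j → indep (0# ∷ 0# ∷ β) (≈ᴹ-trans (pad β) β≈0) (suc (suc j))) , id
    where
    unit : Fin n → Fin n → Carrier
    unit i j with i Fin.≟ j
    ... | yes _ = 1#
    ... | no  _ = 0#
    unit-≢ : ∀ i j → j ≢ i → unit i j ≈ 0#
    unit-≢ i j j≢i with i Fin.≟ j
    ... | yes i≡j = contradiction (≡.sym i≡j) j≢i
    ... | no  _   = refl
    unit-≡ : ∀ i → unit i i ≈ 1#
    unit-≡ i with i Fin.≟ i
    ... | yes _   = refl
    ... | no  i≢i = contradiction ≡.refl i≢i
    c∈ : ∀ j → c j ≈ᴹ combination V (unit j) c
    c∈ j = ≈ᴹ-sym (≈ᴹ-trans (combination-single c j (unit-≢ j)) (≈ᴹ-trans (*ₗ-congʳ (unit-≡ j)) (*ₗ-identityˡ _)))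

  -- For `s` invertible modulo t these are all t conjugates of x, in an order depending on `s`.
  conjugates : ℕ → Carrier → Fin t → Carrier
  conjugates s x i = φ (Fin.toℕ i ℕ.* s) x

  w : ℕ → Carrier → Carrierᴹ
  w s x = combination V (conjugates s x) e

  w-cong : ∀ s {x y} → x ≈ y → w s x ≈ᴹ w s y
  w-cong s x≈y = combination-congˡ e (λ i → φ-cong (Fin.toℕ i ℕ.* s) x≈y)

  w-+ : ∀ s x y → w s (x + y) ≈ᴹ w s x +ᴹ w s y
  w-+ s x y = ≈ᴹ-trans (combination-congˡ e (λ i → φ-+ (Fin.toℕ i ℕ.* s) x y)) (combination-+ (conjugates s x) (conjugates s y) e)

  w-0 : ∀ s → w s 0# ≈ᴹ 0ᴹ
  w-0 s = combination-0 e (λ i → φ-0 (Fin.toℕ i ℕ.* s))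

  -- Fermat's theorem in F, which has order q, carried over to K.
  φ-embed : ∀ i a → φ i (embed a) ≈ embed a
  φ-embed i a = φ-fixed (trans (φ₁ (embed a)) (trans (sym (embed-^ a q)) (⟦⟧-cong (FiniteField.x^N≈x F finF a)))) i
    where
    open Embedding ι
    open FieldExtension ι using (⟦⟧-cong)

  w-* : ∀ s a x → w s (embed a * x) ≈ᴹ embed a *ₗ w s x
  w-* s a x = ≈ᴹ-trans
    (combination-congˡ e (λ i → trans (φ-* (Fin.toℕ i ℕ.* s) (embed a) x) (*-congʳ (φ-embed (Fin.toℕ i ℕ.* s) a))))
    (combination-* (embed a) (conjugates s x) e)

  coord-w : ∀ s x i → coord (w s x) i ≈ conjugates s x i
  coord-w s x = coord-≈ {w s x} {conjugates s x} ≈ᴹ-refl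

  w-≈0 : ∀ s {x} → w s x ≈ᴹ 0ᴹ → x ≈ 0#
  w-≈0 s {x} wx≈0 = trans (sym (φ₀ x)) (indep (conjugates s x) wx≈0 zero)

  w-≉0 : ∀ s {x} → x ≉ 0# → w s x ≉ᴹ 0ᴹ
  w-≉0 s x≉0 wx≈0 = x≉0 (w-≈0 s wx≈0)

  W : ℕ → Subspace (restrictScalars ι V)
  W s = record
    { Member    = λ v → ∃[ x ] v ≈ᴹ w s x
    ; resp      = λ u≈v (x , u≈) → x , ≈ᴹ-trans (≈ᴹ-sym u≈v) u≈
    ; 0-closed  = 0# , ≈ᴹ-sym (w-0 s)
    ; +-closed  = λ (x , u≈) (y , v≈) → x + y , ≈ᴹ-trans (+ᴹ-cong u≈ v≈) (≈ᴹ-sym (w-+ s x y))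
    ; *ₗ-closed = λ a (x , u≈) → embed a * x , ≈ᴹ-trans (*ₗ-congˡ u≈) (≈ᴹ-sym (w-* s a x))
    }

  Σ[_] : ℕ → PointSet V ℓ
  Σ[ s ] P = ∃[ v ] v ∈ Member (W s) × v ≉ᴹ 0ᴹ × ⟦ P ⟧ ≐ ⟨_⟩ V v

  Σ⇒ : ∀ s P → P ∈ Σ[ s ] → ∃[ x ] x ≉ 0# × ⟦ P ⟧ ≐ ⟨_⟩ V (w s x)
  Σ⇒ s P (v , (x , v≈) , v≉0 , P≐) =
    x , (λ x≈0 → v≉0 (≈ᴹ-trans v≈ (≈ᴹ-trans (w-cong s x≈0) (w-0 s)))) , ≐-trans P≐ (⟨⟩-cong v≈)

  Σ⇐ : ∀ s P {x} → x ≉ 0# → ⟦ P ⟧ ≐ ⟨_⟩ V (w s x) → P ∈ Σ[ s ]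
  Σ⇐ s P {x} x≉0 P≐ = w s x , (x , ≈ᴹ-refl) , w-≉0 s x≉0 , P≐

  K/F : VectorSpace F
  K/F = restrictScalars ι (TensorUnit.leftModule {R = ring})

  V/F : VectorSpace F
  V/F = restrictScalars ι V

  K/F-basis : HasDim K/F U t
  K/F-basis = BasisExtension.basis F finF K/F finK

  -- `w s` is F-linear and injective, so it carries an F-basis of K to one of `W s`.
  W-dim : ∀ s → HasDim V/F (Member (W s)) t
  W-dim s = let (b , _ , b-indep , b-spans) = K/F-basis in
      (w s ∘ b) , (λ i → b i , ≈ᴹ-refl)
    , (λ a eq → b-indep a (w-≈0 s (≈ᴹ-trans (w-combination a b) eq)))
    , (λ (x , v≈) → let (a , x≈) = b-spans {x} _ in a , ≈ᴹ-trans v≈ (≈ᴹ-trans (w-cong s x≈) (w-combination a b)))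
    where
    w-combination : ∀ {m} (a : Fin m → Field.Carrier F) b → w s (combination K/F a b) ≈ᴹ combination V/F a (w s ∘ b)
    w-combination = Combinations.combination-linear K/F V/F (w s) (w-0 s) (w-+ s) (w-* s)

  -- Invertibility of `s` makes the t characters in `w s` distinct, and then `spanning` recovers
  -- every combination of the basis `e`.
  subgeometry : ∀ {s} → s InvertibleMod t → IsCanonicalSubgeometry ι V t Σ[ s ]
  subgeometry {s} inv = W s , W-dim s , W-spans , ≐-refl
    where
    W-spans : ∀ v → v ∈ Span V (Member (W s))
    W-spans v = let (m , a , x , x∈ , eq) = spanning V (λ i → q ℕ.^ (Fin.toℕ i ℕ.* s)) (λ i → q^≢0 (Fin.toℕ i ℕ.* s))
                                              (distinct-multiples inv) e (coord v)
                in m , a , x , x∈ , ≈ᴹ-trans (proj₂ (spans v)) eq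

  disjoint : ∀ s {P} → P ∈ Σ[ s ] → ¬ (P ∈ points V Γ)
  disjoint s {P} P∈Σ P∈Γ = let (x , x≉0 , P≐) = Σ⇒ s P P∈Σ in x≉0 (vanishes x P≐)
    where
    vanishes : ∀ x → ⟦ P ⟧ ≐ ⟨_⟩ V (w s x) → x ≈ 0#
    vanishes x P≐ = trans (sym (φ₀ x)) (trans (sym (coord-w s x zero)) (Γ⇒coord₀ (w s x) (P∈Γ (proj₂ P≐ (self∈⟨⟩ (w s x))))))

  -- The component of `w s x` in Λ, hence its projection from Γ; `depth` is the component in Γ.
  shadow : ℕ → Carrier → Carrierᴹ
  shadow s x = conjugates s x zero *ₗ u₀ +ᴹ conjugates s x (suc zero) *ₗ u₁

  depth : ℕ → Carrier → Carrierᴹ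
  depth s x = combination V (λ j → conjugates s x (suc (suc j))) c

  depth∈Γ : ∀ s x → depth s x ∈ Member Γ
  depth∈Γ s x = (λ j → conjugates s x (suc (suc j))) , ≈ᴹ-refl

  w≈shadow+depth : ∀ s x → w s x ≈ᴹ shadow s x +ᴹ depth s x
  w≈shadow+depth s x = ≈ᴹ-sym (+ᴹ-assoc _ _ _)

  plane-≈ : ∀ a b → a *ₗ u₀ +ᴹ b *ₗ u₁ ≈ᴹ combination V (a ∷ b ∷ λ _ → 0#) e
  plane-≈ a b = +ᴹ-congˡ (≈ᴹ-sym (≈ᴹ-trans (+ᴹ-congˡ (combination-0 c (λ _ → refl))) (+ᴹ-identityʳ _)))

  coord-plane₀ : ∀ a b → coord (a *ₗ u₀ +ᴹ b *ₗ u₁) zero ≈ a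
  coord-plane₀ a b = coord-≈ {a = a ∷ b ∷ λ _ → 0#} (plane-≈ a b) zero

  coord-plane₁ : ∀ a b → coord (a *ₗ u₀ +ᴹ b *ₗ u₁) (suc zero) ≈ b
  coord-plane₁ a b = coord-≈ {a = a ∷ b ∷ λ _ → 0#} (plane-≈ a b) (suc zero)

  scale-plane : ∀ k a b → k *ₗ (a *ₗ u₀ +ᴹ b *ₗ u₁) ≈ᴹ (k * a) *ₗ u₀ +ᴹ (k * b) *ₗ u₁
  scale-plane k a b = ≈ᴹ-trans (*ₗ-distribˡ k _ _) (+ᴹ-cong (≈ᴹ-sym (*ₗ-assoc k a u₀)) (≈ᴹ-sym (*ₗ-assoc k b u₁)))

  -- A normal form for vectors of the join of Γ with a point: Γ is a subspace, so all contributions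
  -- from it merge into a single γ.
  span⇒ : ∀ {u} {X : Pred Carrierᴹ ℓ} → X ⊆ ⟨_⟩ V u → ∀ {m} (a : Fin m → Carrier) (x : Fin m → Carrierᴹ) →
          (∀ i → x i ∈ Member Γ ∪ X) → ∃₂ λ k γ → γ ∈ Member Γ × combination V a x ≈ᴹ k *ₗ u +ᴹ γ
  span⇒ {u} X⊆ {zero}  a x x∈ = 0# , 0ᴹ , Subspace.0-closed Γ ,
    ≈ᴹ-sym (≈ᴹ-trans (+ᴹ-identityʳ _) (*ₗ-zeroˡ u))
  span⇒ {u} X⊆ {suc m} a x x∈ with span⇒ X⊆ (a ∘ suc) (x ∘ suc) (x∈ ∘ suc) | x∈ zero
  ... | k , γ , γ∈ , eq | inj₁ x₀∈Γ = k , a zero *ₗ x zero +ᴹ γ ,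
    Subspace.+-closed Γ (Subspace.*ₗ-closed Γ (a zero) x₀∈Γ) γ∈ , (begin
      a zero *ₗ x zero +ᴹ combination V (a ∘ suc) (x ∘ suc)  ≈⟨ +ᴹ-congˡ eq ⟩
      a zero *ₗ x zero +ᴹ (k *ₗ u +ᴹ γ)    ≈⟨ +ᴹ-assoc _ _ _ ⟨
      a zero *ₗ x zero +ᴹ k *ₗ u +ᴹ γ      ≈⟨ +ᴹ-congʳ (+ᴹ-comm _ _) ⟩
      k *ₗ u +ᴹ a zero *ₗ x zero +ᴹ γ      ≈⟨ +ᴹ-assoc _ _ _ ⟩
      k *ₗ u +ᴹ (a zero *ₗ x zero +ᴹ γ)    ∎)
  ... | k , γ , γ∈ , eq | inj₂ x₀∈X with X⊆ x₀∈X
  ...   | d , x₀≈ = a zero * d + k , γ , γ∈ , (begin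
      a zero *ₗ x zero +ᴹ combination V (a ∘ suc) (x ∘ suc)  ≈⟨ +ᴹ-cong (*ₗ-congˡ x₀≈) eq ⟩
      a zero *ₗ (d *ₗ u) +ᴹ (k *ₗ u +ᴹ γ)  ≈⟨ +ᴹ-assoc _ _ _ ⟨
      a zero *ₗ (d *ₗ u) +ᴹ k *ₗ u +ᴹ γ    ≈⟨ +ᴹ-congʳ (+ᴹ-congʳ (*ₗ-assoc (a zero) d u)) ⟨
      (a zero * d) *ₗ u +ᴹ k *ₗ u +ᴹ γ     ≈⟨ +ᴹ-congʳ (*ₗ-distribʳ u (a zero * d) k) ⟨
      (a zero * d + k) *ₗ u +ᴹ γ           ∎)

  module _ (Λ : Subspace V) (Λ-span : Member Λ ≐ (λ v → ∃₂ λ a b → v ≈ᴹ a *ₗ u₀ +ᴹ b *ₗ u₁)) where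

    Γ⊥Λ : ∀ P → P ∈ points V Γ → ¬ (P ∈ points V Λ)
    Γ⊥Λ P P∈Γ P∈Λ = let (v , v≉0 , v∈P) = generator P in v≉0 (vanishes v (P∈Γ v∈P) (proj₁ Λ-span (P∈Λ v∈P)))
      where
      vanishes : ∀ v → v ∈ Member Γ → ∃₂ (λ a b → v ≈ᴹ a *ₗ u₀ +ᴹ b *ₗ u₁) → v ≈ᴹ 0ᴹ
      vanishes v v∈Γ (a , b , v≈) = ≈ᴹ-trans v≈ (≈ᴹ-trans (+ᴹ-cong
        (≈ᴹ-trans (*ₗ-congʳ (trans (sym (coord-plane₀ a b)) (trans (coord-cong (≈ᴹ-sym v≈) zero) (Γ⇒coord₀ v v∈Γ)))) (*ₗ-zeroˡ u₀))
        (≈ᴹ-trans (*ₗ-congʳ (trans (sym (coord-plane₁ a b)) (trans (coord-cong (≈ᴹ-sym v≈) (suc zero)) (Γ⇒coord₁ v v∈Γ)))) (*ₗ-zeroˡ u₁)))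
        (+ᴹ-identityˡ 0ᴹ))

    -- Vectors of Γ have zero coordinates at indices 0 and 1, and vectors of Λ are determined by
    -- these two coordinates.
    projected : ∀ s x {X : Pred Carrierᴹ ℓ} → X ≐ ⟨_⟩ V (w s x) →
                (Span V (Member Γ ∪ X) ∩ Member Λ) ≐ ⟨_⟩ V (shadow s x)
    projected s x {X} (X⊆ , X⊇) =
        (λ {v} ((m , a , y , y∈ , v≈) , v∈Λ) → let (k , γ , γ∈ , eq) = span⇒ X⊆ a y y∈ in
          k , project v k γ γ∈ (≈ᴹ-trans v≈ eq) (proj₁ Λ-span v∈Λ))
      , (λ {v} (k , v≈) →
          -- Two generators suffice, since the shadow is `w s x` minus `depth s x`, and the latter
          -- lies in Γ.
          (2 , (k ∷ (- k) ∷ []) , (w s x ∷ depth s x ∷ []) ,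
            (λ { zero → inj₂ (X⊇ (self∈⟨⟩ _)) ; (suc zero) → inj₁ (depth∈Γ s x) }) ,
            ≈ᴹ-trans v≈ (lift k))
        , proj₂ Λ-span (_ , _ , ≈ᴹ-trans v≈ (scale-plane k _ _)))
      where
      project : ∀ v k γ → γ ∈ Member Γ → v ≈ᴹ k *ₗ w s x +ᴹ γ → ∃₂ (λ a b → v ≈ᴹ a *ₗ u₀ +ᴹ b *ₗ u₁) → v ≈ᴹ k *ₗ shadow s x
      project v k γ γ∈ v≈ (a , b , v≈ab) = ≈ᴹ-trans v≈ab (≈ᴹ-trans
        (+ᴹ-cong (*ₗ-congʳ (trans (sym (coord-plane₀ a b)) (same zero (Γ⇒coord₀ γ γ∈))))
                 (*ₗ-congʳ (trans (sym (coord-plane₁ a b)) (same (suc zero) (Γ⇒coord₁ γ γ∈)))))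
        (≈ᴹ-sym (scale-plane k _ _)))
        where
        same : ∀ i → coord γ i ≈ 0# → coord (a *ₗ u₀ +ᴹ b *ₗ u₁) i ≈ k * conjugates s x i
        same i γᵢ≈0 = trans (coord-cong (≈ᴹ-trans (≈ᴹ-sym v≈ab) v≈) i) (trans (coord-+ (k *ₗ w s x) γ i)
          (trans (+-cong (trans (coord-* k (w s x) i) (*-congˡ (coord-w s x i))) γᵢ≈0) (+-identityʳ _)))

      lift : ∀ k → k *ₗ shadow s x ≈ᴹ k *ₗ w s x +ᴹ ((- k) *ₗ depth s x +ᴹ 0ᴹ)
      lift k = ≈ᴹ-sym (begin
        k *ₗ w s x +ᴹ ((- k) *ₗ depth s x +ᴹ 0ᴹ)
          ≈⟨ +ᴹ-cong (≈ᴹ-trans (*ₗ-congˡ (w≈shadow+depth s x)) (*ₗ-distribˡ k (shadow s x) (depth s x))) (+ᴹ-identityʳ _) ⟩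
        k *ₗ shadow s x +ᴹ k *ₗ depth s x +ᴹ (- k) *ₗ depth s x
          ≈⟨ +ᴹ-assoc _ _ _ ⟩
        k *ₗ shadow s x +ᴹ (k *ₗ depth s x +ᴹ (- k) *ₗ depth s x)
          ≈⟨ +ᴹ-congˡ (≈ᴹ-trans (≈ᴹ-sym (*ₗ-distribʳ _ k (- k))) (≈ᴹ-trans (*ₗ-congʳ (-‿inverseʳ k)) (*ₗ-zeroˡ _))) ⟩
        k *ₗ shadow s x +ᴹ 0ᴹ
          ≈⟨ +ᴹ-identityʳ _ ⟩
        k *ₗ shadow s x ∎)

    -- The right-hand side is free of `s`, which is why different subgeometries have the same
    -- projection.
    projection-Σ : ∀ {s} → s InvertibleMod t → projection V Γ Λ Σ[ s ] ≐
                   (λ Q → ∃[ y ] y ≉ 0# × ⟦ Q ⟧ ≐ ⟨_⟩ V (y *ₗ u₀ +ᴹ (y ^ q) *ₗ u₁))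
    projection-Σ {s} inv =
        (λ {Q} (P , P∈Σ , Q≐) → let (x , x≉0 , P≐) = Σ⇒ s P P∈Σ
                                    (y , y≉0 , eq) = line⊆ inv x≉0
                                in y , y≉0 , ≐-trans Q≐ (≐-trans (projected s x P≐) (≐-sym (⟨⟩-proportional x≉0 y≉0 (same x y (trans (*-comm x _) eq))))))
      , (λ {Q} (y , y≉0 , Q≐) → let (x , x≉0 , eq) = line⊇ inv y≉0
                                    P = point zero? (w-≉0 s x≉0)
                                in P , Σ⇐ s P x≉0 ≐-refl ,
                                   ≐-trans Q≐ (≐-trans (⟨⟩-proportional x≉0 y≉0 (same x y (trans (sym eq) (*-comm _ y))))
                                     (≐-sym (projected s x ≐-refl))))
      where
      same : ∀ x y → x * φ 1 y ≈ y * φ (1 ℕ.* s) x → x *ₗ (y *ₗ u₀ +ᴹ (y ^ q) *ₗ u₁) ≈ᴹ y *ₗ shadow s x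
      same x y eq = ≈ᴹ-trans (scale-plane x _ _) (≈ᴹ-trans
        (+ᴹ-cong (*ₗ-congʳ (trans (*-comm x y) (*-congˡ (sym (φ₀ x))))) (*ₗ-congʳ (trans (*-congˡ (sym (φ₁ y))) eq)))
        (≈ᴹ-sym (scale-plane y _ _)))

  zeroᴹ? : ∀ v → Dec (v ≈ᴹ 0ᴹ)
  zeroᴹ? v = Dec.map′
    (λ v≈0 → coord-injective (λ i → trans (v≈0 i) (sym (coord-0 i))))
    (λ v≈0 i → trans (coord-cong v≈0 i) (coord-0 i))
    (Fin.all? (λ i → coord v i ≟ 0#))
    where
    coord-0 : ∀ i → coord 0ᴹ i ≈ 0#
    coord-0 = coord-≈ {a = λ _ → 0#} (≈ᴹ-sym (combination-0 e (λ _ → refl)))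

  -- No collineation fixes the centre and maps one subgeometry to the other.

  module Rigidity {s : ℕ} (2≤s : 2 ℕ.≤ s) (s+1<t : suc s ℕ.< t) (i₂ : Fin n) (i₂≡0 : Fin.toℕ i₂ ≡ 0)
    (f : Collineation V)
    (f-Γ : image V V (Collineation.map f) (points V Γ) ≐ points V Γ)
    (f-Σ : image V V (Collineation.map f) Σ[ 1 ] ≐ Σ[ s ]) where
    open Collineation f
    open IsRingIsomorphism isRingIsomorphism using ()
      renaming (⟦⟧-cong to σ-cong; *-homo to σ-*; 1#-homo to σ-1; surjective to σ-surjective)
    open IsGroupIsomorphism isGroupIsomorphism using ()
      renaming (⟦⟧-cong to map-cong; ∙-homo to map-+; ε-homo to map-0; injective to map-injective)
    open SemiringSolver commutativeSemiring using (solve; _:+_; _:*_; _:=_)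
    private module K = SetoidReasoning setoid

    σ-^ : ∀ x m → σ (x ^ m) ≈ σ x ^ m
    σ-^ x zero    = σ-1
    σ-^ x (suc m) = trans (σ-* x (x ^ m)) (*-congˡ (σ-^ x m))

    σ⁻¹ : ∀ y → ∃[ x ] σ x ≈ y
    σ⁻¹ y = let (x , σ≈) = σ-surjective y in x , σ≈ refl

    map-≉0 : ∀ {v} → v ≉ᴹ 0ᴹ → map v ≉ᴹ 0ᴹ
    map-≉0 v≉0 fv≈0 = v≉0 (map-injective (≈ᴹ-trans fv≈0 (≈ᴹ-sym map-0)))

    image-⟨⟩ : ∀ v → ⟨_⟩ V (map v) ≐ imageᵛ V V map (⟨_⟩ V v)
    image-⟨⟩ v = ≐-sym (imageᵛ-⟨⟩ K V V map σ map-cong semilinear σ⁻¹ v)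

    -- The hypothesis concerns points, so it is applied to the point spanned by `v`; the zero vector
    -- spans none and is treated apart.
    map-Γ : ∀ {v} → v ∈ Member Γ → map v ∈ Member Γ
    map-Γ {v} v∈Γ with zeroᴹ? v
    ... | yes v≈0 = Subspace.resp Γ (≈ᴹ-sym (≈ᴹ-trans (map-cong v≈0) map-0)) (Subspace.0-closed Γ)
    ... | no  v≉0 = proj₁ f-Γ {point zero? (map-≉0 v≉0)}
      (point zero? v≉0 , (λ (k , u≈) → Subspace.resp Γ (≈ᴹ-sym u≈) (Subspace.*ₗ-closed Γ k v∈Γ)) , image-⟨⟩ v)
      (self∈⟨⟩ (map v))

    g : Carrier → Carrierᴹ
    g x = map (w 1 x)

    map-Σ : ∀ {x} → x ≉ 0# → ∃₂ λ k y → k ≉ 0# × y ≉ 0# × g x ≈ᴹ k *ₗ w s y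
    map-Σ {x} x≉0 = scaled (Σ⇒ s Q (proj₁ f-Σ {Q} (P , Σ⇐ 1 P x≉0 ≐-refl , image-⟨⟩ (w 1 x))))
      where
      P Q : Point V
      P = point zero? (w-≉0 1 x≉0)
      Q = point zero? (map-≉0 (w-≉0 1 x≉0))
      scaled : ∃[ y ] y ≉ 0# × ⟦ Q ⟧ ≐ ⟨_⟩ V (w s y) → ∃₂ λ k y → k ≉ 0# × y ≉ 0# × g x ≈ᴹ k *ₗ w s y
      scaled (y , y≉0 , Q≐) = let (k , gx≈) = proj₁ Q≐ (self∈⟨⟩ (g x)) in
        k , y , (λ k≈0 → map-≉0 (w-≉0 1 x≉0) (≈ᴹ-trans gx≈ (≈ᴹ-trans (*ₗ-congʳ k≈0) (*ₗ-zeroˡ _)))) , y≉0 , gx≈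

    θ : Carrier → Carrier
    θ = φ s

    -- Coordinates 0, 1 and 2: `i₂` is the first index of the Γ part, so `suc (suc i₂)` has value 2
    -- while `n` stays arbitrary.
    v₀ v₁ v₂ : Carrier → Carrier
    v₀ x = coord (g x) zero
    v₁ x = coord (g x) (suc zero)
    v₂ x = coord (g x) (suc (suc i₂))

    v-+ : ∀ x y i → coord (g (x + y)) i ≈ coord (g x) i + coord (g y) i
    v-+ x y i = trans (coord-cong (≈ᴹ-trans (map-cong (w-+ 1 x y)) (map-+ _ _)) i) (coord-+ (g x) (g y) i)

    v-0 : ∀ {x} → x ≈ 0# → ∀ i → coord (g x) i ≈ 0#
    v-0 {x} x≈0 i = trans (coord-cong (≈ᴹ-trans (map-cong (≈ᴹ-trans (w-cong 1 x≈0) (w-0 1))) (≈ᴹ-trans map-0 (≈ᴹ-sym (*ₗ-zeroˡ 0ᴹ)))) i)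
      (trans (coord-* 0# 0ᴹ i) (zeroˡ _))

    -- A representation of `g x` as λ wₛ(y), with `scale` for λ and `preimage` for y. `ratio` is κ =
    -- φˢ(λ)/λ, specified by a product instead of a quotient.
    record Multiple (x : Carrier) : Set ℓ where
      field
        scale preimage ratio : Carrier
        scale≉0    : scale ≉ 0#
        preimage≉0 : preimage ≉ 0#
        g≈         : g x ≈ᴹ scale *ₗ w s preimage
        ratio≈     : ratio * scale ≈ θ scale

      value : ∀ i → coord (g x) i ≈ scale * φ (Fin.toℕ i ℕ.* s) preimage
      value i = trans (coord-cong g≈ i) (trans (coord-* scale (w s preimage) i) (*-congˡ (coord-w s preimage i)))

      value₀ : v₀ x ≈ scale * preimage
      value₀ = trans (value zero) (*-congˡ (φ₀ preimage))

      value₁ : v₁ x ≈ scale * θ preimage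
      value₁ = trans (value (suc zero)) (*-congˡ (reflexive (≡.cong (λ m → φ m preimage) (ℕ.*-identityˡ s))))

      value₂ : v₂ x ≈ scale * θ (θ preimage)
      value₂ = trans (value (suc (suc i₂))) (*-congˡ (trans
        (reflexive (≡.cong (λ m → φ m preimage) exponent)) (sym (φ-∘ s s preimage))))
        where
        exponent : suc (suc (Fin.toℕ i₂)) ℕ.* s ≡ s ℕ.+ s
        exponent = ≡.trans (≡.cong (λ m → suc (suc m) ℕ.* s) i₂≡0) (≡.cong (s ℕ.+_) (ℕ.+-identityʳ s))

      θ-value : ∀ y → θ (scale * y) ≈ ratio * (scale * θ y)
      θ-value y = trans (φ-* s scale y) (trans (*-congʳ (sym ratio≈)) (*-assoc _ _ _))

      ratio₀ : θ (v₀ x) ≈ ratio * v₁ x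
      ratio₀ = trans (φ-cong s value₀) (trans (θ-value preimage) (*-congˡ (sym value₁)))

      ratio₁ : θ (v₁ x) ≈ ratio * v₂ x
      ratio₁ = trans (φ-cong s value₁) (trans (θ-value (θ preimage)) (*-congˡ (sym value₂)))

      v₁≉0 : v₁ x ≉ 0#
      v₁≉0 v₁≈0 = *-≉0 scale≉0 (φ-≉0 s preimage≉0) (trans (sym value₁) v₁≈0)

    multiple : ∀ {x} → x ≉ 0# → Multiple x
    multiple x≉0 = let (k , y , k≉0 , y≉0 , gx≈) = map-Σ x≉0
                       (k⁻¹ , kk⁻¹≈1) = inverse k≉0 in record
      { scale = k ; preimage = y ; ratio = θ k * k⁻¹ ; scale≉0 = k≉0 ; preimage≉0 = y≉0 ; g≈ = gx≈
      ; ratio≈ = trans (*-assoc (θ k) k⁻¹ k) (trans (*-congˡ (trans (*-comm k⁻¹ k) kk⁻¹≈1)) (*-identityʳ _)) }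

    -- Both sides equal `ratio` times `v₁ x * v₂ x`. With `ratio` eliminated, only additive
    -- functions of x remain, so the identity can be polarised.
    quadratic : ∀ x → θ (v₀ x) * v₂ x ≈ θ (v₁ x) * v₁ x
    quadratic x with x ≟ 0#
    ... | yes x≈0 = trans (trans (*-congˡ (v-0 x≈0 (suc (suc i₂)))) (zeroʳ _)) (sym (trans (*-congˡ (v-0 x≈0 (suc zero))) (zeroʳ _)))
    ... | no  x≉0 = trans (*-congʳ ratio₀) (trans (*-assoc _ _ _) (trans (*-congˡ (*-comm _ _)) (trans (sym (*-assoc _ _ _)) (*-congʳ (sym ratio₁)))))
      where open Multiple (multiple x≉0)

    -- Expands `quadratic` at x + y and cancels its instances at x and y. Nothing is divided by 2,
    -- so characteristic 2 is included.
    polarised : ∀ x y → θ (v₀ x) * v₂ y + θ (v₀ y) * v₂ x ≈ θ (v₁ x) * v₁ y + θ (v₁ y) * v₁ x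
    polarised x y = +-cancelˡ (θ (v₀ x) * v₂ x + θ (v₀ y) * v₂ y) _ _ (K.begin
      A * E + A′ * E′ + (A * E′ + A′ * E)   K.≈⟨ expand A A′ E E′ ⟨
      (A + A′) * (E + E′)                   K.≈⟨ *-cong (additive zero) (v-+ x y (suc (suc i₂))) ⟨
      θ (v₀ (x + y)) * v₂ (x + y)           K.≈⟨ quadratic (x + y) ⟩
      θ (v₁ (x + y)) * v₁ (x + y)           K.≈⟨ *-cong (additive (suc zero)) (v-+ x y (suc zero)) ⟩
      (B + B′) * (D + D′)                   K.≈⟨ expand B B′ D D′ ⟩
      B * D + B′ * D′ + (B * D′ + B′ * D)   K.≈⟨ +-congʳ (+-cong (quadratic x) (quadratic y)) ⟨
      A * E + A′ * E′ + (B * D′ + B′ * D)   K.∎)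
      where
      A = θ (v₀ x)
      A′ = θ (v₀ y)
      B = θ (v₁ x)
      B′ = θ (v₁ y)
      E = v₂ x
      E′ = v₂ y
      D = v₁ x
      D′ = v₁ y
      additive : ∀ i → θ (coord (g (x + y)) i) ≈ θ (coord (g x) i) + θ (coord (g y) i)
      additive i = trans (φ-cong s (v-+ x y i)) (φ-+ s _ _)
      expand : ∀ a a′ c c′ → (a + a′) * (c + c′) ≈ a * c + a′ * c′ + (a * c′ + a′ * c)
      expand = solve 4 (λ a a′ c c′ → (a :+ a′) :* (c :+ c′) := a :* c :+ a′ :* c′ :+ (a :* c′ :+ a′ :* c)) refl

    module _ {x x′} (X : Multiple x) (X′ : Multiple x′) where
      private
        module X = Multiple X
        module X′ = Multiple X′
        y = X.preimage
        y′ = X′.preimage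

      -- Inserting the ratios into `polarised` gives (κ - κ')(v₁ x · v₂ x′ - v₁ x′ · v₂ x) = 0, here
      -- with the negative terms moved across.
      crossed : X.ratio * (v₁ x * v₂ x′) + X′.ratio * (v₁ x′ * v₂ x) ≈ X.ratio * (v₁ x′ * v₂ x) + X′.ratio * (v₁ x * v₂ x′)
      crossed = K.begin
        X.ratio * (v₁ x * v₂ x′) + X′.ratio * (v₁ x′ * v₂ x)
          K.≈⟨ +-cong (trans (sym (*-assoc _ _ _)) (*-congʳ (sym X.ratio₀))) (trans (sym (*-assoc _ _ _)) (*-congʳ (sym X′.ratio₀))) ⟩
        θ (v₀ x) * v₂ x′ + θ (v₀ x′) * v₂ x
          K.≈⟨ polarised x x′ ⟩
        θ (v₁ x) * v₁ x′ + θ (v₁ x′) * v₁ x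
          K.≈⟨ +-cong (trans (*-congʳ X.ratio₁) (flip _ _ _)) (trans (*-congʳ X′.ratio₁) (flip _ _ _)) ⟩
        X.ratio * (v₁ x′ * v₂ x) + X′.ratio * (v₁ x * v₂ x′) K.∎
        where
        flip : ∀ a b c → a * b * c ≈ a * (c * b)
        flip = solve 3 (λ a b c → a :* b :* c := a :* (c :* b)) refl

      crossed-cancel : X.ratio ≉ X′.ratio → v₁ x * v₂ x′ ≈ v₁ x′ * v₂ x
      crossed-cancel κ≉κ′ = *-cancelˡ (λ κ-κ′≈0 → κ≉κ′ (x-y≈0⇒x≈y _ _ κ-κ′≈0)) (K.begin
        (κ - κ′) * μ              K.≈⟨ [y-z]x≈yx-zx μ κ κ′ ⟩
        κ * μ - κ′ * μ            K.≈⟨ move crossed ⟩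
        κ * μ′ - κ′ * μ′          K.≈⟨ [y-z]x≈yx-zx μ′ κ κ′ ⟨
        (κ - κ′) * μ′             K.∎)
        where
        open RingProperties ring using ([y-z]x≈yx-zx)
        κ = X.ratio
        κ′ = X′.ratio
        μ = v₁ x * v₂ x′
        μ′ = v₁ x′ * v₂ x
        move : ∀ {a b c d} → a + b ≈ c + d → a - d ≈ c - b
        move {a} {b} {c} {d} eq = +-cancelʳ (b + d) _ _ (K.begin
          a - d + (b + d)      K.≈⟨ solve 4 (λ a nd b d → a :+ nd :+ (b :+ d) := a :+ b :+ (nd :+ d)) refl a (- d) b d ⟩
          a + b + (- d + d)    K.≈⟨ +-cong eq (trans (-‿inverseˡ d) (sym (-‿inverseˡ b))) ⟩
          c + d + (- b + b)    K.≈⟨ solve 4 (λ c d nb b → c :+ d :+ (nb :+ b) := c :+ nb :+ (b :+ d)) refl c d (- b) b ⟩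
          c - b + (b + d)      K.∎)

      -- If the cross terms agree, then y′ = αy with α fixed by θ, so g x and g x′ are proportional.
      dependent : v₁ x * v₂ x′ ≈ v₁ x′ * v₂ x → ∃[ ρ ] g x′ ≈ᴹ ρ *ₗ g x
      dependent m≈m′ = ρ , (begin
        g x′                               ≈⟨ X′.g≈ ⟩
        X′.scale *ₗ w s y′                 ≈⟨ *ₗ-congˡ wy′≈ ⟩
        X′.scale *ₗ (α *ₗ w s y)           ≈⟨ *ₗ-assoc _ _ _ ⟨
        (X′.scale * α) *ₗ w s y            ≈⟨ *ₗ-congʳ (trans (sym (*-identityʳ _)) (*-congˡ (sym (trans (*-comm k⁻¹ X.scale) kk⁻¹≈1)))) ⟩
        (X′.scale * α * (k⁻¹ * X.scale)) *ₗ w s y ≈⟨ *ₗ-congʳ (sym (*-assoc _ _ _)) ⟩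
        (ρ * X.scale) *ₗ w s y             ≈⟨ *ₗ-assoc _ _ _ ⟩
        ρ *ₗ (X.scale *ₗ w s y)            ≈⟨ *ₗ-congˡ X.g≈ ⟨
        ρ *ₗ g x                           ∎)
        where
        y⁻¹ = proj₁ (inverse X.preimage≉0)
        yy⁻¹≈1 = proj₂ (inverse X.preimage≉0)
        k⁻¹ = proj₁ (inverse X.scale≉0)
        kk⁻¹≈1 = proj₂ (inverse X.scale≉0)
        α = y′ * y⁻¹
        ρ = X′.scale * α * k⁻¹

        αy≈y′ : α * y ≈ y′
        αy≈y′ = trans (*-assoc y′ y⁻¹ y) (trans (*-congˡ (trans (*-comm y⁻¹ y) yy⁻¹≈1)) (*-identityʳ y′))

        θ-cross : y * θ y′ ≈ y′ * θ y
        -- Once the two scales are cancelled, the assumption on the cross terms is the image under θ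
        -- of the claim.
        θ-cross = φ-injective s (K.begin
          θ (y * θ y′)         K.≈⟨ φ-* s y (θ y′) ⟩
          θ y * θ (θ y′)       K.≈⟨ *-cancelˡ (*-≉0 X.scale≉0 X′.scale≉0) (K.begin
            X.scale * X′.scale * (θ y * θ (θ y′))     K.≈⟨ regroup X.scale X′.scale (θ y) (θ (θ y′)) ⟩
            X.scale * θ y * (X′.scale * θ (θ y′))     K.≈⟨ *-cong X.value₁ X′.value₂ ⟨
            v₁ x * v₂ x′                              K.≈⟨ m≈m′ ⟩
            v₁ x′ * v₂ x                              K.≈⟨ *-cong X′.value₁ X.value₂ ⟩
            X′.scale * θ y′ * (X.scale * θ (θ y))     K.≈⟨ regroup X′.scale X.scale (θ y′) (θ (θ y)) ⟨
            X′.scale * X.scale * (θ y′ * θ (θ y))     K.≈⟨ *-congʳ (*-comm _ _) ⟩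
            X.scale * X′.scale * (θ y′ * θ (θ y))     K.∎) ⟩
          θ y′ * θ (θ y)       K.≈⟨ φ-* s y′ (θ y) ⟨
          θ (y′ * θ y)         K.∎)
          where
          regroup : ∀ a b c d → a * b * (c * d) ≈ a * c * (b * d)
          regroup = solve 4 (λ a b c d → a :* b :* (c :* d) := a :* c :* (b :* d)) refl

        θα≈α : θ α ≈ α
        θα≈α = *-cancelˡ (*-≉0 X.preimage≉0 (φ-≉0 s X.preimage≉0)) (K.begin
          y * θ y * θ α     K.≈⟨ trans (*-assoc _ _ _) (*-congˡ (*-comm _ _)) ⟩
          y * (θ α * θ y)   K.≈⟨ *-congˡ (trans (sym (φ-* s α y)) (φ-cong s αy≈y′)) ⟩
          y * θ y′          K.≈⟨ θ-cross ⟩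
          y′ * θ y          K.≈⟨ *-congʳ αy≈y′ ⟨
          α * y * θ y       K.≈⟨ trans (*-assoc _ _ _) (*-comm _ _) ⟩
          y * θ y * α       K.∎)

        wy′≈ : w s y′ ≈ᴹ α *ₗ w s y
        -- Each coordinate of `w s` applies an iterate of θ, and all of these fix α.
        wy′≈ = ≈ᴹ-trans
          (combination-congˡ e (λ i → trans (φ-cong (Fin.toℕ i ℕ.* s) (sym αy≈y′))
            (trans (φ-* (Fin.toℕ i ℕ.* s) α y) (*-congʳ (φ-fixed-multiples θα≈α (Fin.toℕ i))))))
          (combination-* α (conjugates s y) e)

      -- Pulling ρ back through `σ` gives w 1 x′ = ρ′ w 1 x. Coordinates 0 and 1 then show x′ = ρ′ x
      -- and φ(ρ′) = ρ′; as `σ` commutes with powers, φ fixes ρ as well.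
      θ-fixes : x ≉ 0# → ∀ {ρ} → g x′ ≈ᴹ ρ *ₗ g x → θ ρ ≈ ρ
      θ-fixes x≉0 {ρ} gx′≈ = φ-fixed (trans (φ-cong 1 (sym σρ′≈ρ)) (trans (sym (σ-^ ρ′ (q ℕ.^ 1))) (trans (σ-cong fixed) σρ′≈ρ))) s
        where
        ρ′ = proj₁ (σ⁻¹ ρ)
        σρ′≈ρ = proj₂ (σ⁻¹ ρ)
        wx′≈ : w 1 x′ ≈ᴹ ρ′ *ₗ w 1 x
        wx′≈ = map-injective (≈ᴹ-trans gx′≈ (≈ᴹ-sym (≈ᴹ-trans (semilinear ρ′ (w 1 x)) (*ₗ-congʳ σρ′≈ρ))))
        conjugate : ∀ i → conjugates 1 x′ i ≈ ρ′ * conjugates 1 x i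
        conjugate i = trans (sym (coord-w 1 x′ i)) (trans (coord-cong wx′≈ i) (trans (coord-* ρ′ (w 1 x) i) (*-congˡ (coord-w 1 x i))))
        x′≈ : x′ ≈ ρ′ * x
        x′≈ = trans (sym (φ₀ x′)) (trans (conjugate zero) (*-congˡ (φ₀ x)))
        fixed : φ 1 ρ′ ≈ ρ′
        fixed = *-cancelˡ (φ-≉0 1 x≉0) (K.begin
          φ 1 x * φ 1 ρ′    K.≈⟨ *-comm _ _ ⟩
          φ 1 ρ′ * φ 1 x    K.≈⟨ φ-* 1 ρ′ x ⟨
          φ 1 (ρ′ * x)      K.≈⟨ φ-cong 1 x′≈ ⟨
          φ 1 x′            K.≈⟨ conjugate (suc zero) ⟩
          ρ′ * φ 1 x        K.≈⟨ *-comm _ _ ⟩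
          φ 1 x * ρ′        K.∎)

      -- Unequal ratios would make `g x′` a multiple of `g x` by a scalar fixed by θ. Such a scalar
      -- cancels from θ(v₀)/v₁, so the ratios agree even then.
      ratio-unique : x ≉ 0# → X.ratio ≈ X′.ratio
      ratio-unique x≉0 with X.ratio ≟ X′.ratio
      ... | yes κ≈κ′ = κ≈κ′
      ... | no  κ≉κ′ = *-cancelˡ X′.v₁≉0 (K.begin
        v₁ x′ * X.ratio         K.≈⟨ *-congʳ (scaled (suc zero)) ⟩
        ρ * v₁ x * X.ratio      K.≈⟨ trans (*-assoc _ _ _) (*-congˡ (trans (*-comm _ _) (sym X.ratio₀))) ⟩
        ρ * θ (v₀ x)            K.≈⟨ *-congʳ (θ-fixes x≉0 gx′≈) ⟨
        θ ρ * θ (v₀ x)          K.≈⟨ φ-* s ρ (v₀ x) ⟨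
        θ (ρ * v₀ x)            K.≈⟨ φ-cong s (scaled zero) ⟨
        θ (v₀ x′)               K.≈⟨ X′.ratio₀ ⟩
        X′.ratio * v₁ x′        K.≈⟨ *-comm _ _ ⟩
        v₁ x′ * X′.ratio        K.∎)
        where
        ρ = proj₁ (dependent (crossed-cancel κ≉κ′))
        gx′≈ = proj₂ (dependent (crossed-cancel κ≉κ′))
        scaled : ∀ i → coord (g x′) i ≈ ρ * coord (g x) i
        scaled i = trans (coord-cong gx′≈ i) (coord-* ρ (g x) i)

    M₁ : Multiple 1#
    M₁ = multiple 1≉0

    κ : Carrier
    κ = Multiple.ratio M₁

    ratio-constant : ∀ x → θ (v₀ x) ≈ κ * v₁ x
    ratio-constant x with x ≟ 0#
    ... | yes x≈0 = trans (trans (φ-cong s (v-0 x≈0 zero)) (φ-0 s)) (sym (trans (*-congˡ (v-0 x≈0 (suc zero))) (zeroʳ κ)))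
    ... | no  x≉0 = trans (Multiple.ratio₀ (multiple x≉0)) (*-congʳ (sym (ratio-unique M₁ (multiple x≉0) 1≉0)))

    -- The Γ part of `w 1 x` stays in Γ and is invisible to such a coordinate, so only the images of
    -- `u₀` and `u₁` contribute.
    coord-g : ∀ x i → (∀ v → v ∈ Member Γ → coord v i ≈ 0#) →
              coord (g x) i ≈ φ 0 (σ x) * coord (map u₀) i + φ 1 (σ x) * coord (map u₁) i
    coord-g x i Γ⇒0 = trans (coord-cong gx≈ i) (trans (coord-+ _ _ i) (trans
      (+-cong (trans (coord-+ _ _ i) (+-cong (coord-* _ _ i) (coord-* _ _ i))) (Γ⇒0 _ (map-Γ (depth∈Γ 1 x))))
      (+-identityʳ _)))
      where
      gx≈ : g x ≈ᴹ φ 0 (σ x) *ₗ map u₀ +ᴹ φ 1 (σ x) *ₗ map u₁ +ᴹ map (depth 1 x)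
      gx≈ = ≈ᴹ-trans (map-cong (w≈shadow+depth 1 x)) (≈ᴹ-trans (map-+ _ _) (+ᴹ-congʳ (≈ᴹ-trans (map-+ _ _)
        (+ᴹ-cong (≈ᴹ-trans (semilinear _ u₀) (*ₗ-congʳ (σ-^ x (q ℕ.^ 0)))) (≈ᴹ-trans (semilinear _ u₁) (*ₗ-congʳ (σ-^ x (q ℕ.^ 1))))))))

    a b a′ b′ : Carrier
    a  = coord (map u₀) zero
    b  = coord (map u₁) zero
    a′ = coord (map u₀) (suc zero)
    b′ = coord (map u₁) (suc zero)

    -- Surjectivity of `σ` frees z = σ(x) to range over all of K, as the independence of characters
    -- requires.
    identity : ∀ z → θ (φ 0 z * a + φ 1 z * b) ≈ κ * (φ 0 z * a′ + φ 1 z * b′)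
    identity z = K.begin
      θ (φ 0 z * a + φ 1 z * b)         K.≈⟨ φ-cong s (+-cong (z≈ 0 _) (z≈ 1 _)) ⟩
      θ (φ 0 (σ x) * a + φ 1 (σ x) * b) K.≈⟨ φ-cong s (coord-g x zero Γ⇒coord₀) ⟨
      θ (v₀ x)                          K.≈⟨ ratio-constant x ⟩
      κ * v₁ x                          K.≈⟨ *-congˡ (coord-g x (suc zero) Γ⇒coord₁) ⟩
      κ * (φ 0 (σ x) * a′ + φ 1 (σ x) * b′) K.≈⟨ *-congˡ (+-cong (z≈ 0 _) (z≈ 1 _)) ⟨
      κ * (φ 0 z * a′ + φ 1 z * b′)     K.∎
      where
      x = proj₁ (σ⁻¹ z)
      z≈ : ∀ i y → φ i z * y ≈ φ i (σ x) * y
      z≈ i y = *-congʳ (φ-cong i (sym (proj₂ (σ⁻¹ z))))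

    -- `s + 0` and `s + 1` arise from θ after `φ 0` and `φ 1`. The bounds 2 ≤ s and s + 1 < t keep
    -- the four characters distinct.
    exponents : Fin 4 → ℕ
    exponents = 0 ∷ 1 ∷ s ℕ.+ 0 ∷ s ℕ.+ 1 ∷ []

    exponents<t : ∀ i → exponents i ℕ.< t
    exponents<t zero                   = ℕ.s≤s ℕ.z≤n
    exponents<t (suc zero)             = ℕ.s≤s (ℕ.s≤s ℕ.z≤n)
    exponents<t (suc (suc zero))       = ℕ.≤-<-trans (ℕ.+-monoʳ-≤ s ℕ.z≤n) (exponents<t (suc (suc (suc zero))))
    exponents<t (suc (suc (suc zero))) = ≡.subst (ℕ._< t) (ℕ.+-comm 1 s) s+1<t

    exponents-injective : ∀ i j → exponents i ≡ exponents j → i ≡ j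
    exponents-injective = injective 2≤s
      where
      2≤⇒≢ : ∀ m k → m ℕ.< 2 → ¬ (m ≡ s ℕ.+ k)
      2≤⇒≢ m k m<2 m≡ = ℕ.<⇒≢ (ℕ.<-≤-trans m<2 (ℕ.≤-trans 2≤s (ℕ.m≤m+n s k))) m≡
      injective : 2 ℕ.≤ s → ∀ i j → exponents i ≡ exponents j → i ≡ j
      injective _ zero zero _ = ≡.refl
      injective _ (suc zero) (suc zero) _ = ≡.refl
      injective _ (suc (suc zero)) (suc (suc zero)) _ = ≡.refl
      injective _ (suc (suc (suc zero))) (suc (suc (suc zero))) _ = ≡.refl
      injective _ zero (suc (suc zero)) eq = contradiction eq (2≤⇒≢ 0 0 (ℕ.s≤s ℕ.z≤n))
      injective _ zero (suc (suc (suc zero))) eq = contradiction eq (2≤⇒≢ 0 1 (ℕ.s≤s ℕ.z≤n))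
      injective _ (suc zero) (suc (suc zero)) eq = contradiction eq (2≤⇒≢ 1 0 ℕ.≤-refl)
      injective _ (suc zero) (suc (suc (suc zero))) eq = contradiction eq (2≤⇒≢ 1 1 ℕ.≤-refl)
      injective _ (suc (suc zero)) zero eq = contradiction (≡.sym eq) (2≤⇒≢ 0 0 (ℕ.s≤s ℕ.z≤n))
      injective _ (suc (suc (suc zero))) zero eq = contradiction (≡.sym eq) (2≤⇒≢ 0 1 (ℕ.s≤s ℕ.z≤n))
      injective _ (suc (suc zero)) (suc zero) eq = contradiction (≡.sym eq) (2≤⇒≢ 1 0 ℕ.≤-refl)
      injective _ (suc (suc (suc zero))) (suc zero) eq = contradiction (≡.sym eq) (2≤⇒≢ 1 1 ℕ.≤-refl)
      injective _ (suc (suc zero)) (suc (suc (suc zero))) eq = contradiction (ℕ.+-cancelˡ-≡ s 0 1 eq) λ ()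
      injective _ (suc (suc (suc zero))) (suc (suc zero)) eq = contradiction (ℕ.+-cancelˡ-≡ s 1 0 eq) λ ()

    coefficients : Fin 4 → Carrier
    coefficients = - (κ * a′) ∷ - (κ * b′) ∷ θ a ∷ θ b ∷ []

    K¹ : VectorSpace K
    K¹ = TensorUnit.leftModule {R = ring}

    coefficients≈0 : ∀ i → coefficients i ≈ 0#
    coefficients≈0 = Characters.independence K finK K¹ (λ i → q ℕ.^ exponents i) (λ i → q^≢0 (exponents i))
      (distinct-powers exponents exponents<t exponents-injective) coefficients vanish
      where
      vanish : ∀ z → combination K¹ (λ i → z ^ (q ℕ.^ exponents i)) coefficients ≈ 0#
      vanish z = K.begin
        φ 0 z * - (κ * a′) + (φ 1 z * - (κ * b′) + (φ (s ℕ.+ 0) z * θ a + (φ (s ℕ.+ 1) z * θ b + 0#)))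
          K.≈⟨ +-cong (negate (φ 0 z) a′) (+-cong (negate (φ 1 z) b′) (+-cong (*-congʳ (sym (φ-∘ s 0 z))) (trans (+-identityʳ _) (*-congʳ (sym (φ-∘ s 1 z)))))) ⟩
        - (κ * (φ 0 z * a′)) + (- (κ * (φ 1 z * b′)) + (θ (φ 0 z) * θ a + θ (φ 1 z) * θ b))
          K.≈⟨ +-assoc _ _ _ ⟨
        - (κ * (φ 0 z * a′)) + - (κ * (φ 1 z * b′)) + (θ (φ 0 z) * θ a + θ (φ 1 z) * θ b)
          K.≈⟨ +-cong (trans (-‿+-comm _ _) (-‿cong (sym (distribˡ κ _ _)))) (trans (+-cong (sym (φ-* s _ _)) (sym (φ-* s _ _))) (sym (φ-+ s _ _))) ⟩
        - (κ * (φ 0 z * a′ + φ 1 z * b′)) + θ (φ 0 z * a + φ 1 z * b)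
          K.≈⟨ +-congˡ (identity z) ⟩
        - (κ * (φ 0 z * a′ + φ 1 z * b′)) + κ * (φ 0 z * a′ + φ 1 z * b′)
          K.≈⟨ -‿inverseˡ _ ⟩
        0# K.∎
        where
        open RingProperties ring using (-‿+-comm)
        negate : ∀ y d → y * - (κ * d) ≈ - (κ * (y * d))
        negate y d = trans (sym (-‿distribʳ-* y (κ * d))) (-‿cong (solve 3 (λ y k d → y :* (k :* d) := k :* (y :* d)) refl y κ d))

    -- Independence gives θ a = θ b = 0, hence a = b = 0, and then the first coordinate of `g 1#`
    -- vanishes although it is a product of two nonzero factors.
    impossible : Empty.⊥
    impossible = *-≉0 (Multiple.scale≉0 M₁) (Multiple.preimage≉0 M₁) (K.begin
      Multiple.scale M₁ * Multiple.preimage M₁  K.≈⟨ Multiple.value₀ M₁ ⟨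
      v₀ 1#                                     K.≈⟨ coord-g 1# zero Γ⇒coord₀ ⟩
      φ 0 (σ 1#) * a + φ 1 (σ 1#) * b           K.≈⟨ +-cong (*-congˡ a≈0) (*-congˡ b≈0) ⟩
      φ 0 (σ 1#) * 0# + φ 1 (σ 1#) * 0#         K.≈⟨ +-cong (zeroʳ _) (zeroʳ _) ⟩
      0# + 0#                                   K.≈⟨ +-identityˡ 0# ⟩
      0#                                        K.∎)
      where
      a≈0 : a ≈ 0#
      a≈0 = φ-≈0 s (coefficients≈0 (suc (suc zero)))
      b≈0 : b ≈ 0#
      b≈0 = φ-≈0 s (coefficients≈0 (suc (suc (suc zero))))

-- The given linear set in adapted coordinates, and the conclusion.

identityCollineation : (K : Field ℓ) (V : VectorSpace K) → Collineation V
identityCollineation K V = record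
  { σ                  = id
  ; isRingIsomorphism  = Identity.isRingIsomorphism (Field.rawRing K) (Field.refl K)
  ; map                = id
  ; isGroupIsomorphism = Identity.isGroupIsomorphism (LeftModule.+ᴹ-rawGroup V) (LeftModule.≈ᴹ-refl V)
  ; semilinear         = λ c v → LeftModule.≈ᴹ-refl V
  }

image-identity : (K : Field ℓ) (V : VectorSpace K) (X : PointSet V p) →
                 (∀ {P Q} → ⟦ P ⟧ ≐ ⟦ Q ⟧ → P ∈ X → Q ∈ X) → image V V id X ≐ X
image-identity K V X X-resp =
    (λ (P , P∈X , Q≐) → X-resp (≐-sym (≐-trans Q≐ (imageᵛ-id P))) P∈X)
  , (λ {Q} Q∈X → Q , Q∈X , ≐-sym (imageᵛ-id Q))
  where
  open LeftModule V
  imageᵛ-id : ∀ P → imageᵛ V V id ⟦ P ⟧ ≐ ⟦ P ⟧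
  imageᵛ-id P = (λ (v , v∈ , u≈v) → Subspace.resp (Point.subspace P) (≈ᴹ-sym u≈v) v∈) , (λ {u} u∈ → u , u∈ , ≈ᴹ-refl)

module LinearSet {q : ℕ} (q-prime-power : IsPrimePower q) {F K : Field ℓ}
  (finF : HasOrder F q) (ι : FieldExtension F K) (V : VectorSpace K)
  (Λ : Subspace V) (ε : Identification (plane K) V Λ) (L : PointSet (plane K) p) (L-type : IsPseudoregulusType K q L)
  where
  open FieldProperties K
  open Combinations V
  private
    module ε = Identification ε
    module P² = LeftModule (plane K)
    module PlanePoints = Points K (plane K)
  open ModuleMorphisms.LeftModuleMorphisms P².rawLeftModule rawLeftModule using (module IsLeftModuleMonomorphism)
  open ModuleMorphisms.LeftModuleMorphisms P².rawLeftModule P².rawLeftModule using (module IsLeftModuleIsomorphism)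
  private
    module εᴸ = IsLeftModuleMonomorphism ε.isLeftModuleMonomorphism
    g = LinearIso.map (proj₁ L-type)
    module gᴸ = IsLeftModuleIsomorphism (LinearIso.isLeftModuleIsomorphism (proj₁ L-type))
    L≐ = proj₂ L-type

  -- The projectivity taking `𝕃 K q` to L is absorbed into the identification with Λ. In the basis
  -- `u₀`, `u₁` the linear set thus becomes the standard one.
  h : P².Carrierᴹ → Carrierᴹ
  h v = ε.map (g v)

  u₀ u₁ : Carrierᴹ
  u₀ = h (1# , 0#)
  u₁ = h (0# , 1#)

  h-cong : ∀ {u v} → u P².≈ᴹ v → h u ≈ᴹ h v
  h-cong u≈v = εᴸ.⟦⟧-cong (gᴸ.⟦⟧-cong u≈v)

  h-* : ∀ k v → h (k P².*ₗ v) ≈ᴹ k *ₗ h v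
  h-* k v = ≈ᴹ-trans (εᴸ.⟦⟧-cong (gᴸ.*ₗ-homo k v)) (εᴸ.*ₗ-homo k (g v))

  h-expand : ∀ a b → h (a , b) ≈ᴹ a *ₗ u₀ +ᴹ b *ₗ u₁
  h-expand a b = ≈ᴹ-trans (h-cong split) (≈ᴹ-trans (εᴸ.⟦⟧-cong (gᴸ.+ᴹ-homo _ _)) (≈ᴹ-trans (εᴸ.+ᴹ-homo _ _)
    (+ᴹ-cong (h-* a (1# , 0#)) (h-* b (0# , 1#)))))
    where
    split : (a , b) P².≈ᴹ ((a P².*ₗ (1# , 0#)) P².+ᴹ (b P².*ₗ (0# , 1#)))
    split = sym (trans (+-cong (*-identityʳ a) (zeroʳ b)) (+-identityʳ a))
          , sym (trans (+-cong (zeroʳ a) (*-identityʳ b)) (+-identityˡ b))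

  h-injective : ∀ {v} → h v ≈ᴹ 0ᴹ → v P².≈ᴹ P².0ᴹ
  h-injective hv≈0 = gᴸ.injective (P².≈ᴹ-trans (εᴸ.injective (≈ᴹ-trans hv≈0 (≈ᴹ-sym εᴸ.0ᴹ-homo))) (P².≈ᴹ-sym gᴸ.0ᴹ-homo))

  u-independent : LinearlyIndependent V (u₀ ∷ u₁ ∷ [])
  u-independent a a≈0 = λ { zero → proj₁ vanish ; (suc zero) → proj₂ vanish }
    where
    vanish = h-injective (≈ᴹ-trans (h-expand (a zero) (a (suc zero))) (≈ᴹ-trans (+ᴹ-congˡ (≈ᴹ-sym (+ᴹ-identityʳ _))) a≈0))

  Λ-span : Member Λ ≐ (λ v → ∃₂ λ a b → v ≈ᴹ a *ₗ u₀ +ᴹ b *ₗ u₁)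
  Λ-span = (λ v∈Λ → let (x , _ , v≈) = proj₁ ε.onto v∈Λ
                        ((a , b) , gab≈) = gᴸ.surjective x
                    in a , b , ≈ᴹ-trans v≈ (≈ᴹ-trans (εᴸ.⟦⟧-cong (P².≈ᴹ-sym (gab≈ P².≈ᴹ-refl))) (h-expand a b)))
         , (λ (a , b , v≈) → proj₂ ε.onto (g (a , b) , _ , ≈ᴹ-trans v≈ (≈ᴹ-sym (h-expand a b))))

  TwoProjections : ℕ → Set (lsuc ℓ ⊔ p)
  TwoProjections t =
    Σ (Subspace V) λ Γ → Σ (PointSet V ℓ) λ Σ₁ → Σ (PointSet V ℓ) λ Σ₂ →
      HasProjDim V (Member Γ) (t ℕ.∸ 3)
      × points V Γ ⊥ points V Λ
      × IsCanonicalSubgeometry ι V t Σ₁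
      × IsCanonicalSubgeometry ι V t Σ₂
      × ¬ (Σ₁ ≐ Σ₂)
      × Σ₁ ⊥ points V Γ
      × Σ₂ ⊥ points V Γ
      × projection V Γ Λ Σ₁ ≐ image (plane K) V (Identification.map ε) L
      × projection V Γ Λ Σ₂ ≐ image (plane K) V (Identification.map ε) L
      × ¬ (Σ (Collineation V) λ φ →
            image V V (Collineation.map φ) (points V Γ) ≐ points V Γ
            × image V V (Collineation.map φ) Σ₁ ≐ Σ₂)

  module _ {n : ℕ} (finK : HasOrder K (q ℕ.^ (3 ℕ.+ n))) (c : Fin (suc n) → Carrierᴹ)
           (indep : BasisExtension.Independent K finK V (u₀ ∷ u₁ ∷ []) c)
           (spans : ∀ v → BasisExtension.InSpan K finK V (u₀ ∷ u₁ ∷ []) c v) where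

    regroup : ∀ a b β → a *ₗ u₀ +ᴹ (b *ₗ u₁ +ᴹ 0ᴹ) +ᴹ combination V β c ≈ᴹ a *ₗ u₀ +ᴹ (b *ₗ u₁ +ᴹ combination V β c)
    regroup a b β = ≈ᴹ-trans (+ᴹ-congʳ (+ᴹ-congˡ (+ᴹ-identityʳ _))) (+ᴹ-assoc _ _ _)

    e-independent : LinearlyIndependent V (u₀ ∷ u₁ ∷ c)
    e-independent a a≈0 = λ { zero → proj₁ vanish zero ; (suc zero) → proj₁ vanish (suc zero) ; (suc (suc j)) → proj₂ vanish j }
      where
      vanish = indep (a zero ∷ a (suc zero) ∷ []) (λ j → a (suc (suc j))) (≈ᴹ-trans (regroup (a zero) (a (suc zero)) (λ j → a (suc (suc j)))) a≈0)

    e-spans : ∀ v → ∃[ a ] v ≈ᴹ combination V a (u₀ ∷ u₁ ∷ c)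
    e-spans v = let ((α , β) , v≈) = spans v in (α zero ∷ α (suc zero) ∷ β) , ≈ᴹ-trans v≈ (regroup _ _ β)

    open Points K V
    open FiniteField K finK using (zero?)
    open Construction {q = q} {suc n} q-prime-power finF finK ι V u₀ u₁ c e-independent e-spans

    image-L : (λ Q → ∃[ y ] y ≉ 0# × ⟦ Q ⟧ ≐ ⟨_⟩ V (y *ₗ u₀ +ᴹ (y ^ q) *ₗ u₁)) ≐ image (plane K) V ε.map L
    image-L =
        (λ {Q} (y , y≉0 , Q≐) →
          let v≉0 : (y , y ^ q) P².≉ᴹ P².0ᴹ
              v≉0 = λ v≈0 → y≉0 (proj₁ v≈0)
              gv≉0 : g (y , y ^ q) P².≉ᴹ P².0ᴹ
              gv≉0 = λ gv≈0 → v≉0 (gᴸ.injective (P².≈ᴹ-trans gv≈0 (P².≈ᴹ-sym gᴸ.0ᴹ-homo)))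
              P = PlanePoints.point zero? gv≉0
          in P , proj₂ L≐ {P} (PlanePoints.point zero? v≉0 , (y , y≉0 , ≐-refl) , ≐-sym (g-⟨⟩ _))
               , ≐-trans Q≐ (≐-trans (⟨⟩-cong (≈ᴹ-sym (h-expand y (y ^ q)))) (≐-sym (ε-⟨⟩ _))))
      , (λ {Q} (P , P∈L , Q≐) →
          let (R , (y , y≉0 , R≐) , P≐) = proj₁ L≐ P∈L
          in y , y≉0 , ≐-trans Q≐ (≐-trans (imageᵛ-cong K (plane K) V ε.map (≐-trans P≐
               (≐-trans (imageᵛ-cong K (plane K) (plane K) g R≐) (g-⟨⟩ _))))
               (≐-trans (ε-⟨⟩ _) (⟨⟩-cong (h-expand y (y ^ q))))))
      where
      g-⟨⟩ : ∀ v → imageᵛ (plane K) (plane K) g (⟨_⟩ (plane K) v) ≐ ⟨_⟩ (plane K) (g v)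
      g-⟨⟩ = imageᵛ-⟨⟩ K (plane K) (plane K) g id gᴸ.⟦⟧-cong gᴸ.*ₗ-homo (λ d → d , refl)
      ε-⟨⟩ : ∀ v → imageᵛ (plane K) V ε.map (⟨_⟩ (plane K) v) ≐ ⟨_⟩ V (ε.map v)
      ε-⟨⟩ = imageᵛ-⟨⟩ K (plane K) V ε.map id εᴸ.⟦⟧-cong εᴸ.*ₗ-homo (λ d → d , refl)

    projects : ∀ {s} → s InvertibleMod t → projection V Γ Λ Σ[ s ] ≐ image (plane K) V ε.map L
    projects inv = ≐-trans (projection-Σ Λ Λ-span inv) image-L

    inequivalent : ∀ {s} → 2 ℕ.≤ s → suc s ℕ.< t →
      ¬ (Σ (Collineation V) λ f → image V V (Collineation.map f) (points V Γ) ≐ points V Γ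
                                × image V V (Collineation.map f) Σ[ 1 ] ≐ Σ[ s ])
    inequivalent 2≤s s+1<t (f , f-Γ , f-Σ) = Rigidity.impossible 2≤s s+1<t zero ≡.refl f f-Γ f-Σ

    -- If the two subgeometries were equal, the identity would be a collineation excluded by
    -- `inequivalent`.
    distinct : ∀ {s} → 2 ℕ.≤ s → suc s ℕ.< t → ¬ (Σ[ 1 ] ≐ Σ[ s ])
    distinct 2≤s s+1<t Σ₁≐Σ₂ = inequivalent 2≤s s+1<t (identityCollineation K V ,
      image-identity K V (points V Γ) (λ P≐Q P∈ v∈Q → P∈ (proj₂ P≐Q v∈Q)) ,
      ≐-trans (image-identity K V Σ[ 1 ] (λ P≐Q (v , v∈ , v≉0 , P≐) → v , v∈ , v≉0 , ≐-trans (≐-sym P≐Q) P≐)) Σ₁≐Σ₂)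

    conclusion : ∀ {s} → 2 ℕ.≤ s → suc s ℕ.< t → s InvertibleMod t →
      TwoProjections t
    conclusion {s} 2≤s s+1<t inv = Γ , Σ[ 1 ] , Σ[ s ]
      , Γ-dim
      , (λ {P} (P∈Γ , P∈Λ) → Γ⊥Λ Λ Λ-span P P∈Γ P∈Λ)
      , subgeometry one
      , subgeometry inv
      , distinct 2≤s s+1<t
      , (λ {P} (P∈Σ , P∈Γ) → disjoint 1 {P} P∈Σ P∈Γ)
      , (λ {P} (P∈Σ , P∈Γ) → disjoint s {P} P∈Σ P∈Γ)
      , projects one
      , projects inv
      , inequivalent 2≤s s+1<t
      where
      one : 1 InvertibleMod t
      one = 1 , 0 , ≡.refl

  two-projections : ∀ {t} → HasOrder K (q ℕ.^ t) → HasDim V U t →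
                    ∀ {s} → 2 ℕ.≤ s → suc s ℕ.< t → s InvertibleMod t → TwoProjections t
  two-projections {t} finK V-dim 2≤s s+1<t inv
    with BasisExtension.extend K finK V {t = t} (BasisExtension.space-finite K finK V V-dim) (u₀ ∷ u₁ ∷ []) u-independent
  -- This would mean t = 2, against 2 ≤ s and s + 1 < t. Otherwise Γ has a first basis vector, which
  -- provides the third coordinate used in `Rigidity`.
  ... | zero  , c , ≡.refl , _     , _     = contradiction (ℕ.≤-trans 2≤s (ℕ.≤-pred (ℕ.<⇒≤ s+1<t))) λ { (ℕ.s≤s ()) }
  ... | suc n , c , ≡.refl , indep , spans = conclusion finK c indep spans 2≤s s+1<t inv

open import Data.Nat using (_<_; _∸_; _^_)

corollary4p6 : {ℓ p : Level} (q t : ℕ) → IsPrimePower q → t ≡ 5 ⊎ 6 < t →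
    (F K : Field ℓ) → HasOrder F q → HasOrder K (q ^ t) → (ι : FieldExtension F K) →
    (V : VectorSpace K) → HasDim V U t →
    (Λ : Subspace V) → HasProjDim V (Member Λ) 1 → (ε : Identification (plane K) V Λ) →
    (L : PointSet (plane K) p) → IsPseudoregulusType K q L →
    Σ (Subspace V) λ Γ → Σ (PointSet V ℓ) λ Σ₁ → Σ (PointSet V ℓ) λ Σ₂ →
    HasProjDim V (Member Γ) (t ∸ 3)
    × points V Γ ⊥ points V Λ
    × IsCanonicalSubgeometry ι V t Σ₁
    × IsCanonicalSubgeometry ι V t Σ₂
    × ¬ (Σ₁ ≐ Σ₂)
    × Σ₁ ⊥ points V Γ
    × Σ₂ ⊥ points V Γ
    × projection V Γ Λ Σ₁ ≐ image (plane K) V (Identification.map ε) L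
    × projection V Γ Λ Σ₂ ≐ image (plane K) V (Identification.map ε) L
    × ¬ (Σ (Collineation V) λ φ →
    image V V (Collineation.map φ) (points V Γ) ≐ points V Γ
    × image V V (Collineation.map φ) Σ₁ ≐ Σ₂)
corollary4p6 q t q-prime-power t-range F K finF finK ι V V-dim Λ _ ε L L-type =
  let (s , 2≤s , s+1<t , inv) = nontrivial-unit t t-range in
  LinearSet.two-projections q-prime-power finF ι V Λ ε L L-type finK V-dim 2≤s s+1<t inv
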